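{- There exists a unique formal power series $Q(x,a)\equiv Q(t,x,a)\in\mathbb{Z}[a,x][[t]]$ satisfying \[ Q(x,a)=t(x+1)^2(1+a)^2+t(1+x)\,\frac{Q(x,a)-Q(x,0)}{a}\left((1+a)^2+a\,\frac{Q(x,a)-Q(0,a)}{x}\right)+t(1+x)\,a\,Q(x,a). \] Moreover, the generating function $W(t)=\sum_{n\ge 1} w_n t^n$ of $3$-stack-sortable permutations satisfies $W(t)=Q(t,0,0)$.
   Context: A permutation is an ordering of a finite set of positive integers; $S_n$ is the set of permutations of $\{1,\dots,n\}$. The stack-sorting map $s$ is defined recursively: $s$ sends the empty permutation to itself, and if $\pi$ is nonempty with largest entry $m$, written $\pi=LmR$, then $s(\pi)=s(L)\,s(R)\,m$ (concatenation). A permutation $\pi$ is $k$-stack-sortable if $s^k(\pi)$ (the $k$-fold iterate) is increasing. Let $w_n$ denote the number of $3$-stack-sortable permutations in $S_n$. The quotients $\frac{Q(x,a)-Q(x,0)}{a}$ and $\frac{Q(x,a)-Q(0,a)}{x}$ are the (polynomial-coefficient) formal power series obtained by exact division. -}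

module Defs where

open import Data.Nat as ℕ using (ℕ; zero; suc; _≤_; _<_; _⊔_)
open import Data.Nat.Properties using (_≟_)
open import Data.Integer as ℤ using (ℤ; +_; -_)
open import Data.List using (List; []; _∷_; _++_; [_]; length; map; upTo; foldr)
open import Data.List.Membership.Propositional using (_∈_)
open import Data.List.Relation.Unary.Unique.Propositional using (Unique)
open import Data.List.Relation.Unary.Linked using (Linked)
open import Data.List.Relation.Binary.Permutation.Propositional using (_↭_)
open import Data.Product using (_×_; _,_; Σ; ∃; ∃-syntax)
open import Data.Sum using (_⊎_)
open import Function.Bundles using (_⇔_)
open import Relation.Nullary using (yes; no)
open import Relation.Binary.PropositionalEquality using (_≡_)

-- largest entry of a list (0 for the empty list; entries are positive)
maxL : List ℕ → ℕ
maxL = foldr _⊔_ 0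

splitFirst : ℕ → List ℕ → List ℕ × List ℕ
splitFirst m [] = [] , []
splitFirst m (y ∷ ys) with y ≟ m
... | yes _ = [] , ys
... | no _ with splitFirst m ys
...   | (L , R) = (y ∷ L) , R

-- s with fuel; since |L|,|R| < |π|, fuel = |π| suffices
sFuel : ℕ → List ℕ → List ℕ
sFuel zero _ = []
sFuel (suc k) [] = []
sFuel (suc k) (y ∷ ys) with splitFirst (maxL (y ∷ ys)) (y ∷ ys)
... | (L , R) = sFuel k L ++ sFuel k R ++ [ maxL (y ∷ ys) ]

stackSort : List ℕ → List ℕ
stackSort π = sFuel (length π) π

iter : ℕ → (List ℕ → List ℕ) → List ℕ → List ℕ
iter zero f π = π
iter (suc k) f π = f (iter k f π)

Increasing : List ℕ → Set
Increasing = Linked _<_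

IsKStackSortable : ℕ → List ℕ → Set
IsKStackSortable k π = Increasing (iter k stackSort π)

IsPerm : ℕ → List ℕ → Set
IsPerm n π = π ↭ map suc (upTo n)

HasCard : (List ℕ → Set) → ℕ → Set
HasCard P k = Σ (List (List ℕ)) λ ps →
  Unique ps × (∀ π → (π ∈ ps) ⇔ P π) × length ps ≡ k

-- Formal power series in ℤ[[t,x,a]]; F n i j = coefficient of t^n x^i a^j

Series : Set
Series = ℕ → ℕ → ℕ → ℤ

PolyCoeffs : Series → Set
PolyCoeffs F = ∀ n → ∃[ B ] ∀ i j → (B ≤ i ⊎ B ≤ j) → F n i j ≡ + 0

ΣZ : ℕ → (ℕ → ℤ) → ℤ
ΣZ n f = foldr ℤ._+_ (+ 0) (map f (upTo (suc n)))

_⊕_ : Series → Series → Series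
(F ⊕ G) n i j = F n i j ℤ.+ G n i j

_⊖_ : Series → Series → Series
(F ⊖ G) n i j = F n i j ℤ.- G n i j

_⊛_ : Series → Series → Series
(F ⊛ G) n i j =
  ΣZ n λ n₁ → ΣZ i λ i₁ → ΣZ j λ j₁ →
    F n₁ i₁ j₁ ℤ.* G (n ℕ.∸ n₁) (i ℕ.∸ i₁) (j ℕ.∸ j₁)

infixl 6 _⊕_ _⊖_
infixl 7 _⊛_

oneS : Series
oneS zero zero zero = + 1
oneS _ _ _ = + 0

tS : Series
tS 1 zero zero = + 1
tS _ _ _ = + 0

xS : Series
xS zero 1 zero = + 1
xS _ _ _ = + 0

aS : Series
aS zero zero 1 = + 1
aS _ _ _ = + 0

atA0 : Series → Series
atA0 F n i zero = F n i 0
atA0 F n i (suc j) = + 0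

atX0 : Series → Series
atX0 F n zero j = F n 0 j
atX0 F n (suc i) j = + 0

-- exact division by a (for a series divisible by a)
divA : Series → Series
divA F n i j = F n i (suc j)

-- exact division by x (for a series divisible by x)
divX : Series → Series
divX F n i j = F n (suc i) j

infix 4 _≈ₛ_
_≈ₛ_ : Series → Series → Set
F ≈ₛ G = ∀ n i j → F n i j ≡ G n i j

QEq : Series → Set
QEq Q = Q ≈ₛ
    tS ⊛ (xS ⊕ oneS) ⊛ (xS ⊕ oneS) ⊛ (oneS ⊕ aS) ⊛ (oneS ⊕ aS)
  ⊕ tS ⊛ (oneS ⊕ xS) ⊛ divA (Q ⊖ atA0 Q)
       ⊛ ((oneS ⊕ aS) ⊛ (oneS ⊕ aS) ⊕ aS ⊛ divX (Q ⊖ atX0 Q))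
  ⊕ tS ⊛ (oneS ⊕ xS) ⊛ aS ⊛ Q

{-# OPTIONS --safe #-}

-- A permutation σ with decreasing binary tree u (σ is the inorder word of u) has s(σ) equal to the
-- postorder word of u, so σ is 3-stack-sortable iff s(σ) = π with s(π) avoiding 231, and the task is to
-- sum |s⁻¹(π)| over these π.
--
-- * Fertility.  With z = a/(1+a)², that is 1 + a = C(z) the Catalan series, the series
--   g_π(a) = Σ_l |s⁻¹(π ⊕ 12…l)| z^l is a polynomial in a.  For π = L n R it equals
--   (g_L - g_L(0)) g_R if R is nonempty and (1+a)² (g_L - g_L(0))/a otherwise.
--   In particular |s⁻¹(π)| = g_π(0); this follows from Σ_{π = αβ} g_α(0) g_β = (1+a)(g_π - g_π(0))/a.
-- * Structure.  Let p(π) - 1 be the number of components of s(π) as a direct sum.  For nonempty L and R,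
--   s(L n R) avoids 231 iff s(L) and s(R) do, all entries of L except its maximum m lie below R, and m lies in
--   value between two consecutive components of s(R) (or at an end).  There are p(R) choices for m, giving
--   p(L n R) = p(L) + 1, …, p(L) + p(R).
--
-- Hence Q = Σ_π t^|π| (1+x)^p(π) g_π(a), over nonempty π with s(π) avoiding 231, solves the equation: its terms
-- account for π = n, for nonempty L (with R empty or not), and for L empty and R nonempty.

module Submission where

open import Defs
open import Algebra.Bundles using (CommutativeRing)
open import Data.Integer as ℤ using (ℤ; +_)
import Data.Integer.Properties as ℤ
open import Data.List using (List; []; _∷_; [_]; _++_; map; concatMap; cartesianProductWith; length; filter;
  drop; take; initLast; _∷ʳ′_; upTo; foldr)
open import Data.List.Membership.Propositional using (_∈_; _∉_)
import Data.List.Membership.Propositional.Properties as ∈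
import Data.List.Properties as List
open import Data.List.Relation.Binary.Disjoint.Propositional using (Disjoint)
open import Data.List.Relation.Binary.Permutation.Propositional as ↭
  using (_↭_; ↭-refl; ↭-sym; ↭-trans; ↭-reflexive; ↭⇒↭ₛ)
import Data.List.Relation.Binary.Permutation.Propositional.Properties as ↭
import Data.List.Relation.Binary.Permutation.Setoid.Properties as ↭ₛ
open import Data.List.Relation.Unary.All as All using (All; []; _∷_)
import Data.List.Relation.Unary.All.Properties as All
open import Data.List.Relation.Unary.AllPairs as AllPairs using (AllPairs; []; _∷_)
import Data.List.Relation.Unary.AllPairs.Properties as AllPairs
open import Data.List.Relation.Unary.Any using (here; there)
import Data.List.Relation.Unary.Linked.Properties as Linked
open import Data.List.Relation.Unary.Unique.Propositional using (Unique)
import Data.List.Relation.Unary.Unique.Propositional.Properties as Unique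
open import Data.Nat as ℕ using (ℕ; zero; suc; z≤n; s≤s; _≤?_; _<_; _⊔_; _∸_; pred)
import Data.Nat.Properties as ℕ
open import Data.Product using (_×_; _,_; Σ; ∃; ∃₂; proj₁; proj₂)
open import Data.Sum using (_⊎_; inj₁; inj₂)
open import Data.Unit using (⊤; tt)
open import Function using (_∘_; id)
open import Function.Bundles using (mk⇔)
open import Level using (0ℓ)
import Relation.Binary.Reasoning.Setoid as SetoidReasoning
open import Relation.Binary.PropositionalEquality as ≡ using (_≡_; _≢_)
open import Relation.Nullary using (yes; no; contradiction)

-- The fertility of `L m` is a sum over all cuts of `L` and is not determined by the fertility of
-- `L` alone, hence the whole series g. The identity for g comes from putting one more maximum
-- behind π ⊕ 12...l and cutting in front of it: (g - g(0))/z = Σ_{π = αβ} g_α(0) g_β + (g - g(0))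
-- C(z), where the last term collects the cuts behind at least one appended entry. Since C(z) = 1 +
-- a and 1/z - C(z) = (1+a)/a, the identity follows; for empty π, g is C(z) = 1 + a itself. No
-- series in z is formed below: g is defined by its recursion on trees, the identity is proved by
-- induction, and its value at a = 0 gives the count. Powers of 1 + x turn the choice of a slot into
-- a divided difference: (1+x) + ... + (1+x)^p = (1+x)((1+x)^p - 1)/x, which summed over all π
-- yields (1+x)(Q - Q(0,a))/x; at x = 0 the statistic p disappears. As g and p depend only on shapes
-- and slots, the equation is proved for unlabelled shapes, and labels enter only in the bijection.

-- Power series over a commutative ring

module Conv (R : CommutativeRing 0ℓ 0ℓ) where
  open CommutativeRing R
  open import Algebra.Solver.Ring.NaturalCoefficients.Default commutativeSemiring
    using (solve; _:+_; _:*_; _:=_)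
  open SetoidReasoning setoid

  Seq : Set
  Seq = ℕ → Carrier

  infix 4 _≋_
  _≋_ : Seq → Seq → Set
  f ≋ g = ∀ n → f n ≈ g n

  δ : Seq → Seq
  δ f n = f (suc n)

  const : Carrier → Seq
  const c zero    = c
  const c (suc n) = 0#

  var : Seq
  var (suc zero) = 1#
  var _          = 0#

  infixl 6 _⊞_
  _⊞_ : Seq → Seq → Seq
  (f ⊞ g) n = f n + g n

  infixl 7 _✶_
  -- The Cauchy product, by recursion on the index through `δ f`, so that identities follow by
  -- induction on the coefficient; `⊛-✶` identifies it with the finite sums of the statement.
  _✶_ : Seq → Seq → Seq
  (f ✶ g) zero    = f 0 * g 0
  (f ✶ g) (suc n) = f 0 * g (suc n) + (δ f ✶ g) n

  -- Coefficient `n` of a product sees only coefficients up to `n`; this locality lets the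
  -- functional equation determine its solution.
  ✶-cong-upTo : ∀ n {f f′ g g′} → (∀ k → k ℕ.≤ n → f k ≈ f′ k) →
                (∀ k → k ℕ.≤ n → g k ≈ g′ k) → (f ✶ g) n ≈ (f′ ✶ g′) n
  ✶-cong-upTo zero    p q = *-cong (p 0 z≤n) (q 0 z≤n)
  ✶-cong-upTo (suc n) p q = +-cong (*-cong (p 0 z≤n) (q (suc n) ℕ.≤-refl))
    (✶-cong-upTo n (λ k k≤n → p (suc k) (s≤s k≤n)) (λ k k≤n → q k (ℕ.m≤n⇒m≤1+n k≤n)))

  ✶-cong : ∀ {f f′ g g′} → f ≋ f′ → g ≋ g′ → f ✶ g ≋ f′ ✶ g′
  ✶-cong p q n = ✶-cong-upTo n (λ k _ → p k) (λ k _ → q k)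

  zeroˡ-✶ : ∀ {f} g → (∀ n → f n ≈ 0#) → ∀ n → (f ✶ g) n ≈ 0#
  zeroˡ-✶ g f≈0 zero    = trans (*-congʳ (f≈0 0)) (zeroˡ _)
  zeroˡ-✶ g f≈0 (suc n) =
    trans (+-cong (trans (*-congʳ (f≈0 0)) (zeroˡ _)) (zeroˡ-✶ g (f≈0 ∘ suc) n)) (+-identityˡ _)

  distribʳ-✶ : ∀ h f g → (f ⊞ g) ✶ h ≋ f ✶ h ⊞ g ✶ h
  distribʳ-✶ h f g zero    = distribʳ _ _ _
  distribʳ-✶ h f g (suc n) = begin
    (f 0 + g 0) * h (suc n) + (δ (f ⊞ g) ✶ h) n
      ≈⟨ +-cong (distribʳ _ _ _) (distribʳ-✶ h (δ f) (δ g) n) ⟩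
    (f 0 * h (suc n) + g 0 * h (suc n)) + ((δ f ✶ h) n + (δ g ✶ h) n)
      ≈⟨ solve 4 (λ a b c d → (a :+ b) :+ (c :+ d) := (a :+ c) :+ (b :+ d)) refl _ _ _ _ ⟩
    (f ✶ h ⊞ g ✶ h) (suc n) ∎

  const-✶ : ∀ c g n → (const c ✶ g) n ≈ c * g n
  const-✶ c g zero    = refl
  const-✶ c g (suc n) = trans (+-congˡ (zeroˡ-✶ g (λ _ → refl) n)) (+-identityʳ _)

  var-✶-suc : ∀ g n → (var ✶ g) (suc n) ≈ g n
  var-✶-suc g n = begin
    0# * g (suc n) + (δ var ✶ g) n  ≈⟨ +-cong (zeroˡ _) (✶-cong δvar (λ _ → refl) n) ⟩
    0# + (const 1# ✶ g) n           ≈⟨ +-identityˡ _ ⟩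
    (const 1# ✶ g) n                ≈⟨ const-✶ 1# g n ⟩
    1# * g n                        ≈⟨ *-identityˡ _ ⟩
    g n                             ∎
    where
    δvar : δ var ≋ const 1#
    δvar zero    = refl
    δvar (suc _) = refl

  -- Splits off the last term of the convolution instead of the first. Commutativity is the match
  -- between the two.
  ✶-suc′ : ∀ f g n → (f ✶ g) (suc n) ≈ (f ✶ δ g) n + f (suc n) * g 0
  ✶-suc′ f g zero    = refl
  ✶-suc′ f g (suc n) = trans (+-congˡ (✶-suc′ (δ f) g n)) (sym (+-assoc _ _ _))

  ✶-comm : ∀ f g → f ✶ g ≋ g ✶ f
  ✶-comm f g zero    = *-comm _ _
  ✶-comm f g (suc n) = begin
    (f ✶ g) (suc n)                   ≈⟨ ✶-suc′ f g n ⟩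
    (f ✶ δ g) n + f (suc n) * g 0     ≈⟨ +-cong (✶-comm f (δ g) n) (*-comm _ _) ⟩
    (δ g ✶ f) n + g 0 * f (suc n)     ≈⟨ +-comm _ _ ⟩
    (g ✶ f) (suc n)                   ∎

  ✶-assoc : ∀ f g h → (f ✶ g) ✶ h ≋ f ✶ (g ✶ h)
  ✶-assoc f g h zero    = *-assoc _ _ _
  ✶-assoc f g h (suc n) = begin
    (f 0 * g 0) * h (suc n) + (δ (f ✶ g) ✶ h) n
      -- Writing `δ (f ✶ g)` as a sum of two products makes distributivity and the induction
      -- hypothesis for `δ f` applicable.
      ≈⟨ +-congˡ (✶-cong (λ k → +-congʳ (sym (const-✶ (f 0) (δ g) k))) (λ _ → refl) n) ⟩
    (f 0 * g 0) * h (suc n) + ((const (f 0) ✶ δ g ⊞ δ f ✶ g) ✶ h) n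
      ≈⟨ +-congˡ (distribʳ-✶ h (const (f 0) ✶ δ g) (δ f ✶ g) n) ⟩
    (f 0 * g 0) * h (suc n) + (((const (f 0) ✶ δ g) ✶ h) n + ((δ f ✶ g) ✶ h) n)
      ≈⟨ +-congˡ (+-cong (scale (f 0) (δ g) n) (✶-assoc (δ f) g h n)) ⟩
    (f 0 * g 0) * h (suc n) + (f 0 * (δ g ✶ h) n + (δ f ✶ (g ✶ h)) n)
      ≈⟨ solve 5 (λ a b c d e → (a :* b) :* c :+ (a :* d :+ e) := a :* (b :* c :+ d) :+ e)
           refl _ _ _ _ _ ⟩
    (f ✶ (g ✶ h)) (suc n) ∎
    where
    scale : ∀ c k m → ((const c ✶ k) ✶ h) m ≈ c * (k ✶ h) m
    scale c k zero    = *-assoc _ _ _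
    scale c k (suc m) = begin
      (c * k 0) * h (suc m) + (δ (const c ✶ k) ✶ h) m
        ≈⟨ +-congˡ (✶-cong (λ j → trans (const-✶ c k (suc j)) (sym (const-✶ c (δ k) j)))
                           (λ _ → refl) m) ⟩
      (c * k 0) * h (suc m) + ((const c ✶ δ k) ✶ h) m
        ≈⟨ +-cong (*-assoc _ _ _) (scale c (δ k) m) ⟩
      c * (k 0 * h (suc m)) + c * (δ k ✶ h) m
        ≈⟨ distribˡ _ _ _ ⟨
      c * (k ✶ h) (suc m) ∎

  δ-✶ : ∀ f g → δ (f ✶ g) ≋ const (f 0) ✶ δ g ⊞ δ f ✶ g
  δ-✶ f g n = +-congʳ (sym (const-✶ (f 0) (δ g) n))

  unfold-δ : ∀ f → f ≋ const (f 0) ⊞ var ✶ δ f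
  unfold-δ f zero    = sym (trans (+-congˡ (zeroˡ _)) (+-identityʳ _))
  unfold-δ f (suc n) = sym (trans (+-identityˡ _) (var-✶-suc (δ f) n))

  private
    ✶-identityˡ : ∀ f → const 1# ✶ f ≋ f
    ✶-identityˡ f n = trans (const-✶ 1# f n) (*-identityˡ _)

  ⟦⟧-ring : CommutativeRing 0ℓ 0ℓ
  ⟦⟧-ring = record
    { Carrier = Seq
    ; _≈_ = _≋_
    ; _+_ = _⊞_
    ; _*_ = _✶_
    ; -_ = λ f n → - f n
    ; 0# = λ _ → 0#
    ; 1# = const 1#
    ; isCommutativeRing = record
      { isRing = record
        { +-isAbelianGroup = record
          { isGroup = record
            { isMonoid = record
              { isSemigroup = record
                { isMagma = record
                  { isEquivalence = record
                    { refl = λ _ → refl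
                    ; sym = λ p n → sym (p n)
                    ; trans = λ p q n → trans (p n) (q n)
                    }
                  ; ∙-cong = λ p q n → +-cong (p n) (q n)
                  }
                ; assoc = λ f g h n → +-assoc _ _ _
                }
              ; identity = (λ f n → +-identityˡ _) , (λ f n → +-identityʳ _)
              }
            ; inverse = (λ f n → -‿inverseˡ _) , (λ f n → -‿inverseʳ _)
            ; ⁻¹-cong = λ p n → -‿cong (p n)
            }
          ; comm = λ f g n → +-comm _ _
          }
        ; *-cong = ✶-cong
        ; *-assoc = ✶-assoc
        ; *-identity = ✶-identityˡ , λ f n → trans (✶-comm f (const 1#) n) (✶-identityˡ f n)
        ; distrib = (λ f g h n → trans (✶-comm f (g ⊞ h) n)
                       (trans (distribʳ-✶ f g h n) (+-cong (✶-comm g f n) (✶-comm h f n))))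
                  , distribʳ-✶
        }
      ; *-comm = ✶-comm
      }
    }

  -- Iterating the construction gives polynomials in several variables.
  record Poly (K : Carrier → Set) (f : Seq) : Set where
    constructor poly
    field
      bounded : ∃ λ b → ∀ i → b ℕ.≤ i → f i ≈ 0#
      coeffs  : ∀ i → K (f i)

  ✶-vanish : ∀ {f g} b c → (∀ i → b ℕ.≤ i → f i ≈ 0#) → (∀ i → c ℕ.≤ i → g i ≈ 0#) →
             ∀ i → b ℕ.+ c ℕ.≤ i → (f ✶ g) i ≈ 0#
  ✶-vanish {f} {g} zero c p q i _ = zeroˡ-✶ g (λ n → p n z≤n) i
  ✶-vanish {f} {g} (suc b) c p q (suc i) (s≤s b+c≤i) = trans
    (+-cong (trans (*-congˡ (q (suc i) (ℕ.m≤n⇒m≤1+n (ℕ.m+n≤o⇒n≤o b b+c≤i)))) (zeroʳ _))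
            (✶-vanish b c (λ k b≤k → p (suc k) (s≤s b≤k)) q i b+c≤i))
    (+-identityˡ _)

  module _ {K : Carrier → Set} (K-0 : K 0#) (K-+ : ∀ {a b} → K a → K b → K (a + b))
           (K-* : ∀ {a b} → K a → K b → K (a * b)) where

    Poly-const : ∀ {c} → K c → Poly K (const c)
    Poly-const k = poly (1 , λ { (suc _) _ → refl }) λ { zero → k ; (suc _) → K-0 }

    Poly-var : K 1# → Poly K var
    Poly-var k = poly (2 , λ { (suc (suc _)) _ → refl ; 1 (s≤s ()) })
                      λ { 0 → K-0 ; 1 → k ; (suc (suc _)) → K-0 }

    Poly-⊞ : ∀ {f g} → Poly K f → Poly K g → Poly K (f ⊞ g)
    Poly-⊞ (poly (b , p) k) (poly (c , q) l) = poly
      (b ℕ.⊔ c , λ i b⊔c≤i → trans (+-cong (p i (ℕ.m⊔n≤o⇒m≤o b c b⊔c≤i)) (q i (ℕ.m⊔n≤o⇒n≤o b c b⊔c≤i)))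
                                   (+-identityˡ _))
      λ i → K-+ (k i) (l i)

    Poly-✶ : ∀ {f g} → Poly K f → Poly K g → Poly K (f ✶ g)
    Poly-✶ {g = g} (poly (b , p) k) (poly (c , q) l) = poly (b ℕ.+ c , ✶-vanish b c p q) (coeff k)
      where
      coeff : ∀ {f} → (∀ i → K (f i)) → ∀ i → K ((f ✶ g) i)
      coeff k zero    = K-* (k 0) (l 0)
      coeff k (suc i) = K-+ (K-* (k 0) (l (suc i))) (coeff (k ∘ suc) i)

    Poly-δ : ∀ {f} → Poly K f → Poly K (δ f)
    Poly-δ (poly (b , p) k) = poly (b , λ i b≤i → p (suc i) (ℕ.m≤n⇒m≤1+n b≤i)) (k ∘ suc)

-- The functional equation

module A = Conv ℤ.+-*-commutativeRing
module X = Conv A.⟦⟧-ring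
module T = Conv X.⟦⟧-ring

module ℤ[a] = CommutativeRing A.⟦⟧-ring
module ℤ[x,a] = CommutativeRing X.⟦⟧-ring
module ℤ[t,x,a] = CommutativeRing T.⟦⟧-ring

ΣZ-suc : ∀ n f → ΣZ (suc n) f ≡ f 0 ℤ.+ ΣZ n (f ∘ suc)
ΣZ-suc n f = ≡.cong (λ l → f 0 ℤ.+ foldr ℤ._+_ (+ 0) l)
  (≡.trans (List.map-applyUpTo suc f (suc n)) (≡.sym (List.map-applyUpTo (λ k → k) (f ∘ suc) (suc n))))

ΣZ-cong : ∀ n {f g} → (∀ k → f k ≡ g k) → ΣZ n f ≡ ΣZ n g
ΣZ-cong n f≗g = ≡.cong (foldr ℤ._+_ (+ 0)) (List.map-cong f≗g (upTo (suc n)))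

module _ (R : CommutativeRing 0ℓ 0ℓ) where
  open CommutativeRing R
  open Conv R using (_✶_)

  -- `ΣZ` adds integers only, so a convolution over a larger ring is compared with it through an
  -- additive coefficient extraction `e`, once for each of the three nested variables.
  ✶-ΣZ : (e : Carrier → ℤ) → (∀ a b → e (a + b) ≡ e a ℤ.+ e b) →
         ∀ n f g → e ((f ✶ g) n) ≡ ΣZ n λ k → e (f k * g (n ℕ.∸ k))
  ✶-ΣZ e e-+ zero    f g = ≡.sym (ℤ.+-identityʳ _)
  ✶-ΣZ e e-+ (suc n) f g = ≡.trans (e-+ _ _)
    (≡.trans (≡.cong (λ z → e (f 0 * g (suc n)) ℤ.+ z) (✶-ΣZ e e-+ n (f ∘ suc) g)) (≡.sym (ΣZ-suc n (λ k → e (f k * g (suc n ℕ.∸ k))))))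

⊛-✶ : ∀ F G → F ⊛ G ≈ₛ F T.✶ G
⊛-✶ F G n i j = ≡.sym
  (≡.trans (✶-ΣZ X.⟦⟧-ring (λ f → f i j) (λ _ _ → ≡.refl) n F G) (ΣZ-cong n λ n₁ →
   ≡.trans (✶-ΣZ A.⟦⟧-ring (λ f → f j) (λ _ _ → ≡.refl) i (F n₁) (G (n ℕ.∸ n₁))) (ΣZ-cong i λ i₁ →
   ✶-ΣZ ℤ.+-*-commutativeRing (λ z → z) (λ _ _ → ≡.refl) j (F n₁ i₁) (G (n ℕ.∸ n₁) (i ℕ.∸ i₁)))))

𝟙+a : ℤ[a].Carrier
𝟙+a = A.const (+ 1) A.⊞ A.var

ν : ℤ[x,a].Carrier → Series
ν = T.const

[a] [x] [1+a] [1+x] : ℤ[x,a].Carrier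
[a]   = X.const A.var
[x]   = X.var
[1+a] = X.const 𝟙+a
[1+x] = X.const (A.const (+ 1)) X.⊞ X.var

Δa Δx : ℤ[x,a].Carrier → ℤ[x,a].Carrier
Δa f i j = f i (suc j)
Δx f i j = f (suc i) j

tS-var : tS ≈ₛ T.var
tS-var 0 zero    zero    = ≡.refl
tS-var 0 zero    (suc j) = ≡.refl
tS-var 0 (suc i) j       = ≡.refl
tS-var 1 zero    zero    = ≡.refl
tS-var 1 zero    (suc j) = ≡.refl
tS-var 1 (suc i) j       = ≡.refl
tS-var (suc (suc n)) i j = ≡.refl

oneS-const : oneS ≈ₛ ℤ[t,x,a].1#
oneS-const zero    zero    zero    = ≡.refl
oneS-const zero    zero    (suc j) = ≡.refl
oneS-const zero    (suc i) j       = ≡.refl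
oneS-const (suc n) i       j       = ≡.refl

xS-const : xS ≈ₛ ν [x]
xS-const zero zero          j       = ≡.refl
xS-const zero 1             zero    = ≡.refl
xS-const zero 1             (suc j) = ≡.refl
xS-const zero (suc (suc i)) j       = ≡.refl
xS-const (suc n) i j                = ≡.refl

aS-const : aS ≈ₛ ν [a]
aS-const zero zero    zero          = ≡.refl
aS-const zero zero    1             = ≡.refl
aS-const zero zero    (suc (suc j)) = ≡.refl
aS-const zero (suc i) j             = ≡.refl
aS-const (suc n) i j                = ≡.refl

1+xS : oneS ⊕ xS ≈ₛ ν [1+x]
1+xS zero    i j = ≡.cong₂ ℤ._+_ (oneS-const 0 i j) (xS-const 0 i j)
1+xS (suc n) i j = ≡.refl

x+1S : xS ⊕ oneS ≈ₛ ν [1+x]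
x+1S n i j = ≡.trans (ℤ.+-comm (xS n i j) (oneS n i j)) (1+xS n i j)

1+aS : oneS ⊕ aS ≈ₛ ν [1+a]
1+aS zero zero    zero    = ≡.refl
1+aS zero zero    (suc j) = ≡.cong₂ ℤ._+_ {x = + 0} ≡.refl (aS-const 0 0 (suc j))
1+aS zero (suc i) j       = ≡.refl
1+aS (suc n) i j          = ≡.refl

-- Subtracting Q(x,0) changes only the coefficient of a⁰, which the shift discards.
divA-⊖ : ∀ Q → divA (Q ⊖ atA0 Q) ≈ₛ Δa ∘ Q
divA-⊖ Q n i j = ℤ.+-identityʳ _

divX-⊖ : ∀ Q → divX (Q ⊖ atX0 Q) ≈ₛ Δx ∘ Q
divX-⊖ Q n i j = ℤ.+-identityʳ _

-- The right side divided by t. The equation thus becomes a recursion: coefficient `suc n` of `Q` is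
-- coefficient `n` of `kernel Q`, which involves `Q` only up to `n`.
kernel : Series → Series
kernel Q = ν [1+x] T.✶ (ν ([1+x] X.✶ ([1+a] X.✶ [1+a]))
  T.⊞ (Δa ∘ Q) T.✶ (ν ([1+a] X.✶ [1+a]) T.⊞ ν [a] T.✶ (Δx ∘ Q))
  T.⊞ ν [a] T.✶ Q)

rhs : Series → Series
rhs Q = tS ⊛ (xS ⊕ oneS) ⊛ (xS ⊕ oneS) ⊛ (oneS ⊕ aS) ⊛ (oneS ⊕ aS)
  ⊕ tS ⊛ (oneS ⊕ xS) ⊛ divA (Q ⊖ atA0 Q)
       ⊛ ((oneS ⊕ aS) ⊛ (oneS ⊕ aS) ⊕ aS ⊛ divX (Q ⊖ atX0 Q))
  ⊕ tS ⊛ (oneS ⊕ xS) ⊛ aS ⊛ Q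

rhs-kernel : ∀ Q → rhs Q ≈ₛ T.var T.✶ kernel Q
rhs-kernel Q = begin
  rhs Q
    ≈⟨ +-cong (+-cong
         (⊛-cong (⊛-cong (⊛-cong (⊛-cong tS-var x+1S) x+1S) 1+aS) 1+aS)
         (⊛-cong (⊛-cong (⊛-cong tS-var 1+xS) (divA-⊖ Q))
                 (+-cong (⊛-cong 1+aS 1+aS) (⊛-cong aS-const (divX-⊖ Q)))))
         (⊛-cong (⊛-cong (⊛-cong tS-var 1+xS) aS-const) refl) ⟩
  t * x * x * a' * a' + t * x * D * (a' * a' + a * E) + t * x * a * Q
    ≈⟨ solve 7 (λ t x a' a D E Q →
         t :* x :* x :* a' :* a' :+ t :* x :* D :* (a' :* a' :+ a :* E) :+ t :* x :* a :* Q
         := t :* (x :* (x :* (a' :* a') :+ D :* (a' :* a' :+ a :* E) :+ a :* Q)))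
         refl t x a' a D E Q ⟩
  t * (x * (x * (a' * a') + D * (a' * a' + a * E) + a * Q))
    ≈⟨ *-congˡ {t} (*-congˡ {x} (+-congʳ {a * Q} (+-cong
         (trans (*-congˡ {x} (ν-✶ [1+a] [1+a])) (ν-✶ [1+x] ([1+a] X.✶ [1+a])))
         (*-congˡ {D} (+-congʳ {a * E} (ν-✶ [1+a] [1+a])))))) ⟩
  T.var T.✶ kernel Q ∎
  where
  open ℤ[t,x,a]
  open SetoidReasoning setoid
  open import Algebra.Solver.Ring.NaturalCoefficients.Default commutativeSemiring
    using (solve; _:+_; _:*_; _:=_)
  t = T.var ; x = ν [1+x] ; a' = ν [1+a] ; a = ν [a] ; D = Δa ∘ Q ; E = Δx ∘ Q
  ⊛-cong : ∀ {F F′ G G′} → F ≈ₛ F′ → G ≈ₛ G′ → F ⊛ G ≈ₛ F′ * G′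
  ⊛-cong {F} {F′} {G} {G′} p q = trans (⊛-✶ F G) (*-cong {F} {F′} {G} {G′} p q)
  ν-✶ : ∀ b c → ν b * ν c ≈ ν (b X.✶ c)
  ν-✶ b c zero    = ℤ[x,a].refl {b X.✶ c}
  ν-✶ b c (suc n) = ℤ[x,a].trans {(ν b * ν c) (suc n)} {b X.✶ ℤ[x,a].0#} (T.const-✶ b (ν c) (suc n)) (ℤ[x,a].zeroʳ b)

kernel-cong-upTo : ∀ n {Q Q′} → (∀ k → k ℕ.≤ n → Q k ℤ[x,a].≈ Q′ k) →
                   kernel Q n ℤ[x,a].≈ kernel Q′ n
kernel-cong-upTo n {Q} {Q′} p =
  T.✶-cong-upTo n {ν [1+x]} {ν [1+x]} (λ k _ → ℤ[x,a].refl {ν [1+x] k}) λ k k≤n → +-cong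
    (+-congˡ {ν ([1+x] X.✶ ([1+a] X.✶ [1+a])) k}
      (T.✶-cong-upTo k {Δa ∘ Q} {Δa ∘ Q′}
        (λ l l≤k i j → p l (ℕ.≤-trans l≤k k≤n) i (suc j))
        (λ l l≤k → +-congˡ {ν ([1+a] X.✶ [1+a]) l} (T.✶-cong-upTo l {ν [a]} {ν [a]}
          (λ m _ → ℤ[x,a].refl {ν [a] m})
          (λ m m≤l i j → p m (ℕ.≤-trans m≤l (ℕ.≤-trans l≤k k≤n)) (suc i) j)))))
    (T.✶-cong-upTo k {ν [a]} {ν [a]} (λ m _ → ℤ[x,a].refl {ν [a] m})
      (λ m m≤k → p m (ℕ.≤-trans m≤k k≤n)))
  where open ℤ[x,a] using (+-cong; +-congˡ)

QEq-kernel : ∀ {Q} → QEq Q → ∀ n → Q (suc n) ℤ[x,a].≈ kernel Q n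
QEq-kernel {Q} eq n = ℤ[x,a].trans {Q (suc n)} (λ i j → ≡.trans (eq (suc n) i j) (rhs-kernel Q (suc n) i j))
  (T.var-✶-suc (kernel Q) n)

kernel-QEq : ∀ {Q} → (∀ i j → Q 0 i j ≡ + 0) → (∀ n → Q (suc n) ℤ[x,a].≈ kernel Q n) → QEq Q
kernel-QEq {Q} Q0 Qs n i j = ≡.trans (lemma n i j) (≡.sym (rhs-kernel Q n i j))
  where
  lemma : Q ≈ₛ T.var T.✶ kernel Q
  lemma zero    = ℤ[x,a].trans {Q 0} Q0 (ℤ[x,a].sym {(T.var T.✶ kernel Q) 0} (ℤ[x,a].zeroˡ (kernel Q 0)))
  lemma (suc n) = ℤ[x,a].trans {Q (suc n)} (Qs n)
    (ℤ[x,a].sym {(T.var T.✶ kernel Q) (suc n)} (T.var-✶-suc (kernel Q) n))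

QEq-zero : ∀ {Q} → QEq Q → ∀ i j → Q 0 i j ≡ + 0
QEq-zero {Q} eq i j = ≡.trans (eq 0 i j) (≡.trans (rhs-kernel Q 0 i j) (ℤ[x,a].zeroˡ (kernel Q 0) i j))

QEq-unique : ∀ {Q Q′} → QEq Q → QEq Q′ → Q ≈ₛ Q′
QEq-unique {Q} {Q′} eq eq′ n = agree n n ℕ.≤-refl
  where
  -- The bound `n` provides strong induction: coefficient `suc k` depends on all earlier ones.
  agree : ∀ n k → k ℕ.≤ n → ∀ i j → Q k i j ≡ Q′ k i j
  agree n       zero    _         i j = ≡.trans (QEq-zero eq i j) (≡.sym (QEq-zero eq′ i j))
  agree (suc n) (suc k) (s≤s k≤n) i j = ≡.trans (QEq-kernel eq k i j)
    (≡.trans (kernel-cong-upTo k {Q} {Q′} (λ l l≤k → agree n l (ℕ.≤-trans l≤k k≤n)) i j)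
             (≡.sym (QEq-kernel eq′ k i j)))

-- Fertilities of decreasing binary trees

module Sum (R : CommutativeRing 0ℓ 0ℓ) where
  open CommutativeRing R

  ∑ : ∀ {I : Set} → (I → Carrier) → List I → Carrier
  ∑ f []       = 0#
  ∑ f (i ∷ is) = f i + ∑ f is

  ∑-cong : ∀ {I : Set} {f g : I → Carrier} → (∀ i → f i ≈ g i) → ∀ is → ∑ f is ≈ ∑ g is
  ∑-cong p []       = refl
  ∑-cong p (i ∷ is) = +-cong (p i) (∑-cong p is)

  ∑-cong-∈ : ∀ {I : Set} {f g : I → Carrier} is → (∀ {i} → i ∈ is → f i ≈ g i) → ∑ f is ≈ ∑ g is
  ∑-cong-∈ []       p = refl
  ∑-cong-∈ (i ∷ is) p = +-cong (p (here ≡.refl)) (∑-cong-∈ is (p ∘ there))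

  ∑-zero : ∀ {I : Set} {f : I → Carrier} → (∀ i → f i ≈ 0#) → ∀ is → ∑ f is ≈ 0#
  ∑-zero p []       = refl
  ∑-zero p (i ∷ is) = trans (+-cong (p i) (∑-zero p is)) (+-identityˡ _)

  ∑-++ : ∀ {I : Set} (f : I → Carrier) is js → ∑ f (is ++ js) ≈ ∑ f is + ∑ f js
  ∑-++ f []       js = sym (+-identityˡ _)
  ∑-++ f (i ∷ is) js = trans (+-congˡ (∑-++ f is js)) (sym (+-assoc _ _ _))

  ∑-map : ∀ {I J : Set} (f : J → Carrier) (h : I → J) is → ∑ f (map h is) ≡ ∑ (f ∘ h) is
  ∑-map f h []       = ≡.refl
  ∑-map f h (i ∷ is) = ≡.cong (λ z → f (h i) + z) (∑-map f h is)

  ∑-*ʳ : ∀ {I : Set} (f : I → Carrier) c is → ∑ (λ i → f i * c) is ≈ ∑ f is * c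
  ∑-*ʳ f c []       = sym (zeroˡ c)
  ∑-*ʳ f c (i ∷ is) = trans (+-congˡ (∑-*ʳ f c is)) (sym (distribʳ _ _ _))

  ∑-*ˡ : ∀ {I : Set} (f : I → Carrier) c is → ∑ (λ i → c * f i) is ≈ c * ∑ f is
  ∑-*ˡ f c []       = sym (zeroʳ c)
  ∑-*ˡ f c (i ∷ is) = trans (+-congˡ (∑-*ˡ f c is)) (sym (distribˡ _ _ _))

  ∑-concatMap : ∀ {I J : Set} (f : J → Carrier) (h : I → List J) is →
                ∑ f (concatMap h is) ≈ ∑ (λ i → ∑ f (h i)) is
  ∑-concatMap f h []       = refl
  ∑-concatMap f h (i ∷ is) = trans (∑-++ f (h i) (concatMap h is)) (+-congˡ (∑-concatMap f h is))

  ∑-cartesian : ∀ {I J K : Set} (f : K → Carrier) (h : I → J → K) is js →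
                ∑ f (cartesianProductWith h is js) ≈ ∑ (λ i → ∑ (λ j → f (h i j)) js) is
  ∑-cartesian f h []       js = refl
  ∑-cartesian f h (i ∷ is) js = trans (∑-++ f (map (h i) js) _)
    (+-cong (reflexive (∑-map f (h i) js)) (∑-cartesian f h is js))

module ∑ℤ = Sum ℤ.+-*-commutativeRing
module ∑A = Sum A.⟦⟧-ring
module ∑X = Sum X.⟦⟧-ring

∑A-coeff : ∀ {I : Set} (f : I → ℤ[a].Carrier) j is → ∑A.∑ f is j ≡ ∑ℤ.∑ (λ i → f i j) is
∑A-coeff f j []       = ≡.refl
∑A-coeff f j (i ∷ is) = ≡.cong (λ z → f i j ℤ.+ z) (∑A-coeff f j is)

∑X-coeff : ∀ {I : Set} (f : I → ℤ[x,a].Carrier) i is → ∑X.∑ f is i ≡ ∑A.∑ (λ k → f k i) is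
∑X-coeff f i []       = ≡.refl
∑X-coeff f i (k ∷ is) = ≡.cong (λ z → f k i A.⊞ z) (∑X-coeff f i is)

data BT : Set where
  leaf : BT
  node : (l : BT) (m : ℕ) (r : BT) → BT

-- The pairs of trees belonging to all factorizations `inorder t` = αβ. A cut falls before the root,
-- inside `l`, or after it, inside `r`.
splits : BT → List (BT × BT)
splits leaf         = [ leaf , leaf ]
splits (node l m r) = map (λ (α , β) → α , node β m r) (splits l)
                   ++ map (λ (α , β) → node l m α , β) (splits r)

-- gf t is g_π for π = inorder t, and gf⁺ r is the factor contributed by a right subtree r.
gf gf⁺ : BT → ℤ[a].Carrier
gf leaf         = 𝟙+a
gf (node l m r) = A.δ (gf l) A.✶ gf⁺ r
gf⁺ leaf             = 𝟙+a A.✶ 𝟙+a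
gf⁺ r@(node _ _ _)   = A.var A.✶ gf r

module _ where
  open ℤ[a]
  open A using (δ; const; var; δ-✶; ✶-cong; unfold-δ)
  open ∑A
  open SetoidReasoning setoid
  open import Algebra.Solver.Ring.NaturalCoefficients.Default commutativeSemiring
    using (solve; _:+_; _:*_; _:=_)

  private
    ∑-δ : ∀ {I : Set} (f : I → Carrier) is → δ (∑ f is) ≈ ∑ (δ ∘ f) is
    ∑-δ f []       n = ≡.refl
    ∑-δ f (i ∷ is) n = ≡.cong (λ z → f i (suc n) ℤ.+ z) (∑-δ f is n)

    δ-cong : ∀ {f g} → f ≈ g → δ f ≈ δ g
    δ-cong p n = p (suc n)

    const-* : ∀ c d → const (c ℤ.* d) ≈ const c * const d
    const-* c d zero    = ≡.refl
    const-* c d (suc n) = ≡.sym (≡.trans (A.const-✶ c (const d) (suc n)) (ℤ.*-zeroʳ c))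

    δ-const-* : ∀ c f → δ (const c * f) ≈ const c * δ f
    δ-const-* c f n = ≡.trans (A.const-✶ c f (suc n)) (≡.sym (A.const-✶ c (δ f) n))

    -- A cut inside `l` leaves `r` intact, so `gf⁺ r` factors out; the rest is linear in `gf β`.
    ∑-left : ∀ (w : BT → ℤ) l m r →
             ∑ (λ (α , β) → const (w α) * gf (node β m r)) (splits l)
             ≈ δ (∑ (λ (α , β) → const (w α) * gf β) (splits l)) * gf⁺ r
    ∑-left w l m r = begin
      ∑ (λ (α , β) → const (w α) * gf (node β m r)) (splits l)
        ≈⟨ ∑-cong (λ (α , β) → sym {const (w α) * δ (gf β) * gf⁺ r}
             (*-assoc (const (w α)) (δ (gf β)) (gf⁺ r))) (splits l) ⟩
      ∑ (λ (α , β) → const (w α) * δ (gf β) * gf⁺ r) (splits l)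
        ≈⟨ ∑-*ʳ (λ (α , β) → const (w α) * δ (gf β)) (gf⁺ r) (splits l) ⟩
      ∑ (λ (α , β) → const (w α) * δ (gf β)) (splits l) * gf⁺ r
        ≈⟨ *-congʳ {gf⁺ r} (trans
             (∑-cong (λ (α , β) → sym {δ (const (w α) * gf β)} (δ-const-* (w α) (gf β))) (splits l))
             (sym {δ (∑ _ (splits l))} (∑-δ (λ (α , β) → const (w α) * gf β) (splits l)))) ⟩
      δ (∑ (λ (α , β) → const (w α) * gf β) (splits l)) * gf⁺ r ∎

  -- Only the cut with empty α contributes: `gf⁺` has constant term 1 at a leaf and 0 at a node,
  -- where it carries the factor a.
  gf⁺-splits : ∀ r → ∑ (λ (α , β) → const (gf⁺ α 0) * gf β) (splits r) ≈ gf r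
  gf⁺-splits leaf = begin
    const (+ 1) * 𝟙+a + 0#   ≈⟨ +-identityʳ _ ⟩
    1# * 𝟙+a                 ≈⟨ *-identityˡ 𝟙+a ⟩
    𝟙+a                      ∎
  gf⁺-splits (node l m r) = begin
    ∑ F (splits (node l m r))
      ≈⟨ ∑-++ F (map (λ (α , β) → α , node β m r) (splits l)) _ ⟩
    ∑ F (map (λ (α , β) → α , node β m r) (splits l)) + ∑ F (map (λ (α , β) → node l m α , β) (splits r))
      ≈⟨ +-cong (reflexive (∑-map F (λ (α , β) → α , node β m r) (splits l)))
                (reflexive (∑-map F (λ (α , β) → node l m α , β) (splits r))) ⟩
    ∑ (λ (α , β) → const (gf⁺ α 0) * gf (node β m r)) (splits l)
      + ∑ (λ (α , β) → const (gf⁺ (node l m α) 0) * gf β) (splits r)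
      ≈⟨ +-cong (∑-left (λ α → gf⁺ α 0) l m r)
           (∑-zero (λ (α , β) → trans {const (+ 0) * gf β} (A.const-✶ (+ 0) (gf β)) (λ _ → ≡.refl)) (splits r)) ⟩
    δ (∑ F (splits l)) * gf⁺ r + 0#
      ≈⟨ +-identityʳ (δ (∑ F (splits l)) * gf⁺ r) ⟩
    δ (∑ F (splits l)) * gf⁺ r
      ≈⟨ *-congʳ {gf⁺ r} {δ (∑ F (splits l))} {δ (gf l)} (δ-cong (gf⁺-splits l)) ⟩
    gf (node l m r) ∎
    where
    F : BT × BT → Carrier
    F (α , β) = const (gf⁺ α 0) * gf β

  1+a-* : ∀ f → f + var * f ≈ 𝟙+a * f
  1+a-* f = begin
    f + var * f       ≈⟨ +-congʳ {var * f} (sym {1# * f} (*-identityˡ f)) ⟩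
    1# * f + var * f  ≈⟨ sym {𝟙+a * f} (distribʳ f 1# var) ⟩
    𝟙+a * f           ∎

  δ-1+a : δ 𝟙+a ≈ 1#
  δ-1+a zero    = ≡.refl
  δ-1+a (suc n) = ≡.refl

  δ-1+a-* : ∀ f → δ (𝟙+a * f) ≈ δ f + f
  δ-1+a-* f = begin
    δ (𝟙+a * f)           ≈⟨ δ-✶ 𝟙+a f ⟩
    1# * δ f + δ 𝟙+a * f  ≈⟨ +-cong (*-identityˡ (δ f)) (trans (*-congʳ {f} δ-1+a) (*-identityˡ f)) ⟩
    δ f + f               ∎

  -- For a leaf, `δ` of (1+a)² is 2 + a; for a node, `δ` removes the factor a. The common form
  -- spares `gf-splits` a distinction between empty and nonempty right subtrees.
  gf⁺-gf : ∀ r → gf⁺ r + gf r ≈ 𝟙+a * δ (gf⁺ r)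
  gf⁺-gf leaf = begin
    𝟙+a * 𝟙+a + 𝟙+a         ≈⟨ +-comm (𝟙+a * 𝟙+a) 𝟙+a ⟩
    𝟙+a + 𝟙+a * 𝟙+a         ≈⟨ +-congʳ {𝟙+a * 𝟙+a} (sym {𝟙+a * 1#} (*-identityʳ 𝟙+a)) ⟩
    𝟙+a * 1# + 𝟙+a * 𝟙+a    ≈⟨ sym {𝟙+a * (1# + 𝟙+a)} (distribˡ 𝟙+a 1# 𝟙+a) ⟩
    𝟙+a * (1# + 𝟙+a)        ≈⟨ *-congˡ {𝟙+a} (sym {δ (𝟙+a * 𝟙+a)}
                                 (trans (δ-1+a-* 𝟙+a) (+-congʳ {𝟙+a} δ-1+a))) ⟩
    𝟙+a * δ (𝟙+a * 𝟙+a)     ∎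
  gf⁺-gf r@(node _ _ _) = begin
    var * gf r + gf r       ≈⟨ +-comm (var * gf r) (gf r) ⟩
    gf r + var * gf r       ≈⟨ 1+a-* (gf r) ⟩
    𝟙+a * gf r              ≈⟨ *-congˡ {𝟙+a} (λ n → ≡.sym (A.var-✶-suc (gf r) n)) ⟩
    𝟙+a * δ (gf⁺ r)         ∎

  -- Induction on the tree: cuts before the root give `δ` of the identity for `l`. Among the cuts
  -- after the root only the one right behind it counts, since `gf (node l m α) 0` vanishes for
  -- nonempty α.
  gf-splits : ∀ t → ∑ (λ (α , β) → const (gf α 0) * gf β) (splits t) ≈ 𝟙+a * δ (gf t)
  gf-splits leaf = begin
    1# * 𝟙+a + 0#  ≈⟨ +-identityʳ (1# * 𝟙+a) ⟩
    1# * 𝟙+a       ≈⟨ *-comm 1# 𝟙+a ⟩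
    𝟙+a * 1#       ≈⟨ *-congˡ {𝟙+a} (sym {δ 𝟙+a} δ-1+a) ⟩
    𝟙+a * δ 𝟙+a    ∎
  gf-splits (node l m r) = begin
    ∑ F (splits (node l m r))
      ≈⟨ ∑-++ F (map (λ (α , β) → α , node β m r) (splits l)) _ ⟩
    ∑ F (map (λ (α , β) → α , node β m r) (splits l)) + ∑ F (map (λ (α , β) → node l m α , β) (splits r))
      ≈⟨ +-cong (reflexive (∑-map F (λ (α , β) → α , node β m r) (splits l)))
                (reflexive (∑-map F (λ (α , β) → node l m α , β) (splits r))) ⟩
    ∑ (λ (α , β) → const (gf α 0) * gf (node β m r)) (splits l)
      + ∑ (λ (α , β) → const (gf (node l m α) 0) * gf β) (splits r)
      ≈⟨ +-cong left right ⟩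
    (k + h) * e + c * gf r
      -- Expanding `h` as `c` plus a times `k` collects the terms with `c` into `e + gf r`, the left
      -- side of `gf⁺-gf`.
      ≈⟨ +-congʳ {c * gf r} (*-congʳ {e} (+-congˡ {k} (unfold-δ h))) ⟩
    (k + (c + var * k)) * e + c * gf r
      ≈⟨ solve 5 (λ k c a e g → (k :+ (c :+ a :* k)) :* e :+ c :* g := (k :+ a :* k) :* e :+ c :* (e :+ g))
           (λ _ → ≡.refl) k c var e (gf r) ⟩
    (k + var * k) * e + c * (e + gf r)
      ≈⟨ +-cong (*-congʳ {e} (1+a-* k)) (*-congˡ {c} (gf⁺-gf r)) ⟩
    𝟙+a * k * e + c * (𝟙+a * δ e)
      ≈⟨ solve 5 (λ u k e c d → u :* k :* e :+ c :* (u :* d) := u :* (c :* d :+ k :* e))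
           (λ _ → ≡.refl) 𝟙+a k e c (δ e) ⟩
    𝟙+a * (c * δ e + k * e)
      ≈⟨ *-congˡ {𝟙+a} (sym {δ (h * e)} (δ-✶ h e)) ⟩
    𝟙+a * δ (gf (node l m r)) ∎
    where
    F : BT × BT → Carrier
    F (α , β) = const (gf α 0) * gf β
    h = δ (gf l) ; k = δ h ; e = gf⁺ r ; c = const (h 0)
    left : ∑ (λ (α , β) → const (gf α 0) * gf (node β m r)) (splits l) ≈ (k + h) * e
    left = begin
      ∑ (λ (α , β) → const (gf α 0) * gf (node β m r)) (splits l)
        ≈⟨ ∑-left (λ α → gf α 0) l m r ⟩
      δ (∑ F (splits l)) * e
        ≈⟨ *-congʳ {e} (trans {δ (∑ F (splits l))} (δ-cong (gf-splits l)) (δ-1+a-* h)) ⟩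
      (k + h) * e ∎
    right : ∑ (λ (α , β) → const (gf (node l m α) 0) * gf β) (splits r) ≈ c * gf r
    right = begin
      ∑ (λ (α , β) → const (h 0 ℤ.* gf⁺ α 0) * gf β) (splits r)
        ≈⟨ ∑-cong (λ (α , β) → trans (*-congʳ {gf β} (const-* (h 0) (gf⁺ α 0)))
             (*-assoc c (const (gf⁺ α 0)) (gf β))) (splits r) ⟩
      ∑ (λ (α , β) → c * (const (gf⁺ α 0) * gf β)) (splits r)
        ≈⟨ ∑-*ˡ (λ (α , β) → const (gf⁺ α 0) * gf β) c (splits r) ⟩
      c * ∑ (λ (α , β) → const (gf⁺ α 0) * gf β) (splits r)
        ≈⟨ *-congˡ {c} (gf⁺-splits r) ⟩
      c * gf r ∎

-- Shapes and their enumeration by size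

open ≡ using (refl)

-- Shapes of the π with s(π) avoiding 231: top R stands for n R and node L R i for L n R with L nonempty, where
-- i counts the entries of R below the maximum of L.
data Tree : Set where
  leaf : Tree
  top  : (R : Tree) → Tree
  node : (L R : Tree) (i : ℕ) → Tree

size : Tree → ℕ
size leaf         = 0
size (top R)      = suc (size R)
size (node L R i) = suc (size L ℕ.+ size R)

-- slots T lists the i such that s(π) is the direct sum of a permutation of size i and another one, so
-- p(π) is its length; inner T omits the trivial cut i = |π|.
inner slots : Tree → List ℕ
inner leaf         = []
inner (top R)      = slots R
inner (node L R i) = map (size L ℕ.+_) (filter (i ≤?_) (slots R)) ++ inner L
slots T = size T ∷ inner T

inner-< : ∀ T → All (ℕ._< size T) (inner T)
inner-< leaf         = []
inner-< (top R)      = ℕ.≤-refl ∷ All.map ℕ.m≤n⇒m≤1+n (inner-< R)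
inner-< (node L R i) = All.++⁺
  (All.map⁺ (All.filter⁺ (i ≤?_) (All.map (λ p → s≤s (ℕ.+-monoʳ-≤ (size L) p))
    (ℕ.≤-refl ∷ All.map ℕ.<⇒≤ (inner-< R)))))
  (All.map (λ p → ℕ.m≤n⇒m≤1+n (ℕ.≤-trans p (ℕ.m≤m+n (size L) (size R)))) (inner-< L))

-- The cuts coming from `R` are shifted by `size L`, hence above every cut in `inner L`. The order
-- makes slots distinct and lets `rank` run through 1, 2, ....
inner-desc : ∀ T → AllPairs ℕ._>_ (inner T)
slots-desc : ∀ T → AllPairs ℕ._>_ (slots T)
inner-desc leaf         = []
inner-desc (top R)      = slots-desc R
inner-desc (node L R i) = AllPairs.++⁺
  (AllPairs.map⁺ (AllPairs.map (ℕ.+-monoʳ-< (size L)) (AllPairs.filter⁺ (i ≤?_) (slots-desc R))))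
  (inner-desc L)
  (All.map⁺ (All.universal (λ j → All.map (λ p → ℕ.≤-trans p (ℕ.m≤m+n (size L) j)) (inner-< L)) _))
slots-desc T = inner-< T ∷ inner-desc T

rank : List ℕ → ℕ → ℕ
rank xs i = length (filter (i ≤?_) xs)

slotted : (ℕ → List Tree) → ℕ → List (Tree × ℕ)
slotted f n = concatMap (λ R → map (R ,_) (slots R)) (f n)

nodes : List Tree → List (Tree × ℕ) → List Tree
nodes = cartesianProductWith (λ L (R , i) → node L R i)

convolve : (ℕ → List Tree) → (ℕ → List (Tree × ℕ)) → ℕ → List Tree
convolve f g zero    = nodes (f 0) (g 0)
convolve f g (suc n) = nodes (f 0) (g (suc n)) ++ convolve (f ∘ suc) g n

grow : (ℕ → List Tree) → ℕ → List Tree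
grow f zero    = map top (f 0)
grow f (suc n) = map top (f (suc n)) ++ convolve (f ∘ suc) (slotted f) n

-- Course-of-values recursion in structural form: row `n` serves the sizes up to `n`, and the next
-- row adds one size by `grow`. Only entries with `k` at most `n` carry meaning.
table : ℕ → ℕ → List Tree
table zero    k = [ leaf ]
table (suc n) k with k ≤? n
... | yes _ = table n k
... | no  _ = grow (table n) n

trees : ℕ → List Tree
trees n = table n n

convolve-cong : ∀ n {f f′ g g′} → (∀ k → k ℕ.≤ n → f k ≡ f′ k) → (∀ k → k ℕ.≤ n → g k ≡ g′ k) →
                convolve f g n ≡ convolve f′ g′ n
convolve-cong zero    p q = ≡.cong₂ nodes (p 0 z≤n) (q 0 z≤n)
convolve-cong (suc n) p q = ≡.cong₂ _++_ (≡.cong₂ nodes (p 0 z≤n) (q (suc n) ℕ.≤-refl))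
  (convolve-cong n (λ k k≤n → p (suc k) (s≤s k≤n)) (λ k k≤n → q k (ℕ.m≤n⇒m≤1+n k≤n)))

grow-cong : ∀ n {f f′} → (∀ k → k ℕ.≤ n → f k ≡ f′ k) → grow f n ≡ grow f′ n
grow-cong zero    p = ≡.cong (map top) (p 0 z≤n)
grow-cong (suc n) p = ≡.cong₂ _++_ (≡.cong (map top) (p (suc n) ℕ.≤-refl))
  (convolve-cong n (λ k k≤n → p (suc k) (s≤s k≤n))
    (λ k k≤n → ≡.cong (concatMap (λ R → map (R ,_) (slots R))) (p k (ℕ.m≤n⇒m≤1+n k≤n))))

table-trees : ∀ n k → k ℕ.≤ n → table n k ≡ trees k
table-trees zero    zero z≤n = refl
table-trees (suc n) k k≤1+n with k ≤? n
... | yes k≤n = table-trees n k k≤n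
... | no  k≰n with refl ← ℕ.≤-antisym k≤1+n (ℕ.≰⇒> k≰n) with suc n ≤? n
...   | yes 1+n≤n = contradiction 1+n≤n k≰n
...   | no  _     = refl

trees-suc : ∀ n → trees (suc n) ≡ grow trees n
trees-suc n with suc n ≤? n
... | yes 1+n≤n = contradiction 1+n≤n (ℕ.<-irrefl refl)
... | no  _     = grow-cong n (table-trees n)

-- `gf` reads nothing but the shape, so slots are dropped and all labels are a dummy 0; `gf-realize`
-- carries the value over to labelled trees.
skeleton : Tree → BT
skeleton leaf         = leaf
skeleton (top R)      = node leaf 0 (skeleton R)
skeleton (node L R i) = node (skeleton L) 0 (skeleton R)

∈-concatMap : ∀ {I J : Set} {f : I → List J} {is y} → y ∈ concatMap f is → ∃ λ i → i ∈ is × y ∈ f i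
∈-concatMap {f = f} {is} p with ys , y∈ys , ys∈ ← ∈.∈-concat⁻′ (map f is) p
  with i , i∈ , refl ← ∈.∈-map⁻ f ys∈ = i , i∈ , y∈ys

∈-concatMap′ : ∀ {I J : Set} {f : I → List J} {is i y} → i ∈ is → y ∈ f i → y ∈ concatMap f is
∈-concatMap′ {f = f} i∈ y∈ = ∈.∈-concat⁺′ y∈ (∈.∈-map⁺ f i∈)

concatMap-unique : ∀ {I J : Set} {f : I → List J} {is} → Unique is → (∀ {i} → i ∈ is → Unique (f i)) →
                   (∀ {i k y} → i ∈ is → k ∈ is → y ∈ f i → y ∈ f k → i ≡ k) → Unique (concatMap f is)
concatMap-unique []        u d = []
concatMap-unique {f = f} {i ∷ is} (i∉ ∷ us) u d = Unique.++⁺ (u (here refl))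
  (concatMap-unique us (u ∘ there) (λ p q → d (there p) (there q)))
  λ (y∈ , y∈′) → let k , k∈ , y∈fk = ∈-concatMap {f = f} y∈′ in
    contradiction (d (here refl) (there k∈) y∈ y∈fk) (All.lookup i∉ k∈)

-- An empty left part belongs to `top`; excluding it from `node` keeps the encoding unique.
Valid : Tree → Set
Valid leaf         = ⊤
Valid (top R)      = Valid R
Valid (node L R i) = Valid L × 0 ℕ.< size L × Valid R × i ∈ slots R

∈-convolve⁻ : ∀ {f g} n {T} → T ∈ convolve f g n →
  ∃₂ λ k r → k ℕ.+ r ≡ n × ∃₂ λ L R → ∃ λ i → L ∈ f k × (R , i) ∈ g r × T ≡ node L R i
∈-convolve⁻ {f} {g} zero p
  with L , (R , i) , L∈ , Ri∈ , refl ← ∈.∈-cartesianProductWith⁻ (λ L (R , i) → node L R i) (f 0) (g 0) p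
  = 0 , 0 , refl , L , R , i , L∈ , Ri∈ , refl
∈-convolve⁻ {f} {g} (suc n) p with ∈.∈-++⁻ (nodes (f 0) (g (suc n))) p
... | inj₁ q with L , (R , i) , L∈ , Ri∈ , refl
                  ← ∈.∈-cartesianProductWith⁻ (λ L (R , i) → node L R i) (f 0) (g (suc n)) q
  = 0 , suc n , refl , L , R , i , L∈ , Ri∈ , refl
... | inj₂ q with k , r , k+r≡n , rest ← ∈-convolve⁻ {f ∘ suc} n q
  = suc k , r , ≡.cong suc k+r≡n , rest

∈-convolve⁺ : ∀ {f g} k r {L R i} → L ∈ f k → (R , i) ∈ g r → node L R i ∈ convolve f g (k ℕ.+ r)
∈-convolve⁺ zero    zero    p q = ∈.∈-cartesianProductWith⁺ _ p q
∈-convolve⁺ zero    (suc r) p q = ∈.∈-++⁺ˡ (∈.∈-cartesianProductWith⁺ _ p q)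
∈-convolve⁺ {f} {g} (suc k) r p q = ∈.∈-++⁺ʳ (nodes (f 0) (g (suc k ℕ.+ r))) (∈-convolve⁺ k r p q)

∈-slotted⁻ : ∀ {f n R i} → (R , i) ∈ slotted f n → R ∈ f n × i ∈ slots R
∈-slotted⁻ {f} {n} p with R , R∈ , q ← ∈-concatMap {f = λ R → map (R ,_) (slots R)} {f n} p
  with i , i∈ , refl ← ∈.∈-map⁻ (R ,_) q = R∈ , i∈

∈-slotted⁺ : ∀ {f n R i} → R ∈ f n → i ∈ slots R → (R , i) ∈ slotted f n
∈-slotted⁺ {R = R} R∈ i∈ = ∈-concatMap′ R∈ (∈.∈-map⁺ (R ,_) i∈)

nodes-unique : ∀ {Ls Rs} → Unique Ls → Unique Rs → Unique (nodes Ls Rs)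
nodes-unique = Unique.cartesianProductWith⁺ _ λ { refl → refl , refl }

-- The blocks are told apart by the size of the left part. The offset `c` lets the size hypothesis
-- survive the passage to `f ∘ suc`.
convolve-unique : ∀ n {c f g} → (∀ k → k ℕ.≤ n → Unique (f k)) → (∀ k → k ℕ.≤ n → Unique (g k)) →
  (∀ k {L} → k ℕ.≤ n → L ∈ f k → size L ≡ c ℕ.+ k) → Unique (convolve f g n)
convolve-unique zero    uf ug s = nodes-unique (uf 0 z≤n) (ug 0 z≤n)
convolve-unique (suc n) {c} {f} {g} uf ug s = Unique.++⁺ (nodes-unique (uf 0 z≤n) (ug (suc n) ℕ.≤-refl))
  (convolve-unique n {suc c} (λ k k≤n → uf (suc k) (s≤s k≤n)) (λ k k≤n → ug k (ℕ.m≤n⇒m≤1+n k≤n))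
    λ k k≤n L∈ → ≡.trans (s (suc k) (s≤s k≤n) L∈) (ℕ.+-suc c k))
  disjoint
  where
  disjoint : Disjoint (nodes (f 0) (g (suc n))) (convolve (f ∘ suc) g n)
  disjoint (p , q)
    with L , (R , i) , L∈ , Ri∈ , refl ← ∈.∈-cartesianProductWith⁻ (λ L (R , i) → node L R i) (f 0) (g (suc n)) p
    with k , r , k+r≡n , _ , _ , _ , L∈′ , _ , refl ← ∈-convolve⁻ {f ∘ suc} n q =
    contradiction (ℕ.+-cancelˡ-≡ c 0 (suc k) (≡.trans (≡.sym (s 0 z≤n L∈))
      (s (suc k) (s≤s (≡.subst (k ℕ.≤_) k+r≡n (ℕ.m≤m+n k r))) L∈′))) λ ()

Enumerates : (ℕ → List Tree) → ℕ → Set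
Enumerates f n = Unique (f n) × (∀ {T} → T ∈ f n → Valid T × size T ≡ n)
               × (∀ {T} → Valid T → size T ≡ n → T ∈ f n)

slots-unique : ∀ T → Unique (slots T)
slots-unique T = AllPairs.map ℕ.>⇒≢ (slots-desc T)

slotted-unique : ∀ {f n} → Unique (f n) → Unique (slotted f n)
slotted-unique {f} {n} u = concatMap-unique u
  (λ {R} _ → Unique.map⁺ (λ { refl → refl }) (slots-unique R)) key
  where
  key : ∀ {R S y} → R ∈ f n → S ∈ f n → y ∈ map (R ,_) (slots R) → y ∈ map (S ,_) (slots S) → R ≡ S
  key {R} {S} _ _ p q with _ , _ , refl ← ∈.∈-map⁻ (R ,_) p with _ , _ , refl ← ∈.∈-map⁻ (S ,_) q = refl

grow-enumerates : ∀ n {f} → (∀ k → k ℕ.≤ n → Enumerates f k) →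
  Unique (grow f n) × (∀ {T} → T ∈ grow f n → Valid T × size T ≡ suc n)
  × (∀ {T} → Valid T → size T ≡ suc n → T ∈ grow f n)
grow-enumerates zero {f} e with u , s , c ← e 0 z≤n = Unique.map⁺ (λ { refl → refl }) u , sound , complete
  where
  sound : ∀ {T} → T ∈ map top (f 0) → Valid T × size T ≡ 1
  sound p with R , R∈ , refl ← ∈.∈-map⁻ top p = proj₁ (s R∈) , ≡.cong suc (proj₂ (s R∈))
  complete : ∀ {T} → Valid T → size T ≡ 1 → T ∈ map top (f 0)
  complete {top R}      v                  eq = ∈.∈-map⁺ top (c v (ℕ.suc-injective eq))
  complete {node L R i} (_ , pos , _ , _) eq =
    contradiction (ℕ.≤-trans pos (ℕ.≤-trans (ℕ.m≤m+n (size L) (size R)) (ℕ.≤-reflexive (ℕ.suc-injective eq)))) λ ()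
grow-enumerates (suc n) {f} e = unique , sound , complete
  where
  unique : Unique (map top (f (suc n)) ++ convolve (f ∘ suc) (slotted f) n)
  unique = Unique.++⁺ (Unique.map⁺ (λ { refl → refl }) (proj₁ (e (suc n) ℕ.≤-refl)))
    (convolve-unique n {1} (λ k k≤n → proj₁ (e (suc k) (s≤s k≤n)))
      (λ k k≤n → slotted-unique {f} (proj₁ (e k (ℕ.m≤n⇒m≤1+n k≤n))))
      (λ k k≤n L∈ → proj₂ (proj₁ (proj₂ (e (suc k) (s≤s k≤n))) L∈)))
    disjoint
    where
    disjoint : Disjoint (map top (f (suc n))) (convolve (f ∘ suc) (slotted f) n)
    disjoint (p , q) with _ , _ , refl ← ∈.∈-map⁻ top p
      with _ , _ , _ , _ , _ , _ , _ , _ , () ← ∈-convolve⁻ {f ∘ suc} n q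
  sound : ∀ {T} → T ∈ grow f (suc n) → Valid T × size T ≡ suc (suc n)
  sound p with ∈.∈-++⁻ (map top (f (suc n))) p
  ... | inj₁ q with R , R∈ , refl ← ∈.∈-map⁻ top q
               with v , eq ← proj₁ (proj₂ (e (suc n) ℕ.≤-refl)) R∈ = v , ≡.cong suc eq
  ... | inj₂ q with k , r , refl , L , R , i , L∈ , Ri∈ , refl ← ∈-convolve⁻ {f ∘ suc} n q
               with R∈ , i∈ ← ∈-slotted⁻ {f} Ri∈
               with vL , sL ← proj₁ (proj₂ (e (suc k) (s≤s (ℕ.m≤m+n k r)))) L∈
               with vR , sR ← proj₁ (proj₂ (e r (ℕ.m≤n⇒m≤1+n (ℕ.m≤n+m r k)))) R∈
    = (vL , ≡.subst (0 ℕ.<_) (≡.sym sL) (s≤s z≤n) , vR , i∈) , ≡.cong₂ (λ a b → suc (a ℕ.+ b)) sL sR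
  complete : ∀ {T} → Valid T → size T ≡ suc (suc n) → T ∈ grow f (suc n)
  complete {top R} v eq = ∈.∈-++⁺ˡ (∈.∈-map⁺ top (proj₂ (proj₂ (e (suc n) ℕ.≤-refl)) v (ℕ.suc-injective eq)))
  complete {node L R i} (vL , pos , vR , i∈) eq with size L in sL
  ... | suc k with refl ← ℕ.suc-injective (ℕ.suc-injective eq) =
    ∈.∈-++⁺ʳ (map top (f (suc n))) (∈-convolve⁺ k (size R)
      (proj₂ (proj₂ (e (suc k) (s≤s (ℕ.m≤m+n k (size R))))) vL sL)
      (∈-slotted⁺ {f} (proj₂ (proj₂ (e (size R) (ℕ.m≤n⇒m≤1+n (ℕ.m≤n+m (size R) k)))) vR refl) i∈))

trees-enumerates : ∀ n → Enumerates trees n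
trees-enumerates n = bounded n n ℕ.≤-refl
  where
  bounded : ∀ n k → k ℕ.≤ n → Enumerates trees k
  bounded n zero _ = [] ∷ [] , (λ { (here refl) → tt , refl }) , λ { {leaf} _ _ → here refl }
  bounded (suc n) (suc k) (s≤s k≤n) rewrite trees-suc k =
    grow-enumerates k (λ l l≤k → bounded n l (ℕ.≤-trans l≤k k≤n))

-- The weighted sum over shapes solves the equation

module _ where
  open ℤ[x,a] hiding (zero; refl)
  open X using (δ; const; var; δ-✶; unfold-δ)
  open ∑X
  open SetoidReasoning setoid
  open import Algebra.Solver.Ring.NaturalCoefficients.Default commutativeSemiring
    using (solve; _:+_; _:*_; _:=_)

  pow : ℕ → Carrier
  pow zero    = 1#
  pow (suc p) = [1+x] * pow p

  pow-+ : ∀ p q → pow (p ℕ.+ q) ≈ pow p * pow q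
  pow-+ zero    q = sym {1# * pow q} (*-identityˡ (pow q))
  pow-+ (suc p) q = begin
    [1+x] * pow (p ℕ.+ q)    ≈⟨ *-congˡ {[1+x]} (pow-+ p q) ⟩
    [1+x] * (pow p * pow q)  ≈⟨ sym {[1+x] * pow p * pow q} (*-assoc [1+x] (pow p) (pow q)) ⟩
    [1+x] * pow p * pow q    ∎

  1+x-* : ∀ f → [1+x] * f ≈ f + var * f
  1+x-* f = begin
    (1# + var) * f    ≈⟨ distribʳ f 1# var ⟩
    1# * f + var * f  ≈⟨ +-congʳ {var * f} (*-identityˡ f) ⟩
    f + var * f       ∎

  pow-0 : ∀ p → pow p 0 ℤ[a].≈ ℤ[a].1#
  pow-0 zero    = λ _ → ≡.refl
  pow-0 (suc p) = ℤ[a].trans {(1# + var) 0 A.✶ pow p 0} (ℤ[a].*-cong {(1# + var) 0} {ℤ[a].1#} {pow p 0} {ℤ[a].1#}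
    (ℤ[a].+-identityʳ ℤ[a].1#) (pow-0 p)) (ℤ[a].*-identityˡ ℤ[a].1#)

  pow-δ : ∀ p → pow p ≈ 1# + var * δ (pow p)
  pow-δ p = begin
    pow p                                ≈⟨ unfold-δ (pow p) ⟩
    const (pow p 0) + var * δ (pow p)    ≈⟨ +-congʳ {var * δ (pow p)} {const (pow p 0)} {1#} (λ { zero → pow-0 p ; (suc _) _ → ≡.refl }) ⟩
    1# + var * δ (pow p)                 ∎

  -- `δ (pow p)` is ((1+x)^p - 1)/x, the sum of (1+x)^j for j < p; this is its recurrence.
  δ-pow-suc : ∀ p → δ (pow (suc p)) ≈ 1# + [1+x] * δ (pow p)
  δ-pow-suc p = begin
    δ (pow (suc p))                        ≈⟨ (λ n → 1+x-* (pow p) (suc n)) ⟩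
    δ (pow p) + δ (var * pow p)            ≈⟨ +-congˡ {δ (pow p)} (X.var-✶-suc (pow p)) ⟩
    δ (pow p) + pow p                      ≈⟨ +-congˡ {δ (pow p)} (pow-δ p) ⟩
    δ (pow p) + (1# + var * δ (pow p))
      ≈⟨ solve 3 (λ d o e → d :+ (o :+ e) := o :+ (d :+ e)) (λ _ _ → ≡.refl) (δ (pow p)) 1# (var * δ (pow p)) ⟩
    1# + (δ (pow p) + var * δ (pow p))     ≈⟨ +-congˡ {1#} (sym {[1+x] * δ (pow p)} (1+x-* (δ (pow p)))) ⟩
    1# + [1+x] * δ (pow p)                 ∎

  rank-here : ∀ {x ys} → All (x ℕ.>_) ys → rank (x ∷ ys) x ≡ 1
  rank-here {x} {ys} x>ys = ≡.cong length (≡.trans (List.filter-accept (x ≤?_) ℕ.≤-refl)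
    (≡.cong (x ∷_) (List.filter-none (x ≤?_) (All.map ℕ.<⇒≱ x>ys))))

  rank-there : ∀ {x ys i} → i ℕ.≤ x → rank (x ∷ ys) i ≡ suc (rank ys i)
  rank-there {i = i} i≤x = ≡.cong length (List.filter-accept (i ≤?_) i≤x)

  -- Along a decreasing list the ranks are 1, 2, ..., p, so the sum is geometric. Here the quotient
  -- by x in the equation originates.
  ∑-rank : ∀ {xs} → AllPairs ℕ._>_ xs → ∑ (λ i → pow (rank xs i)) xs ≈ [1+x] * δ (pow (length xs))
  ∑-rank [] = sym {[1+x] * 0#} (zeroʳ [1+x])
  ∑-rank {x ∷ ys} (x>ys ∷ ds) = begin
    pow (rank (x ∷ ys) x) + ∑ (λ i → pow (rank (x ∷ ys) i)) ys
      ≈⟨ +-cong (reflexive (≡.cong pow (rank-here x>ys)))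
           (∑-cong-∈ ys (λ i∈ → reflexive (≡.cong pow (rank-there (ℕ.<⇒≤ (All.lookup x>ys i∈)))))) ⟩
    [1+x] * 1# + ∑ (λ i → [1+x] * pow (rank ys i)) ys
      ≈⟨ +-congˡ {[1+x] * 1#} (trans (∑-*ˡ (λ i → pow (rank ys i)) [1+x] ys) (*-congˡ {[1+x]} (∑-rank ds))) ⟩
    [1+x] * 1# + [1+x] * ([1+x] * δ (pow (length ys)))
      ≈⟨ sym {[1+x] * (1# + [1+x] * δ (pow (length ys)))} (distribˡ [1+x] 1# ([1+x] * δ (pow (length ys)))) ⟩
    [1+x] * (1# + [1+x] * δ (pow (length ys)))
      ≈⟨ *-congˡ {[1+x]} (sym {δ (pow (suc (length ys)))} (δ-pow-suc (length ys))) ⟩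
    [1+x] * δ (pow (suc (length ys))) ∎

  -- The factor 1 + x is free of a, so it commutes with the shift in a.
  Δa-1+x : ∀ f → Δa ([1+x] * f) ≈ [1+x] * Δa f
  Δa-1+x f i j = ≡.trans (1+x-* f i (suc j)) (≡.trans (≡.cong (λ z → f i (suc j) ℤ.+ z) (Δa-var i j))
    (≡.sym (1+x-* (Δa f) i j)))
    where
    Δa-var : Δa (var * f) ≈ var * Δa f
    Δa-var zero    j = ≡.trans (ℤ[a].zeroˡ (f 0) (suc j)) (≡.sym (ℤ[a].zeroˡ (Δa f 0) j))
    Δa-var (suc i) j = ≡.trans (X.var-✶-suc f i (suc j)) (≡.sym (X.var-✶-suc (Δa f) i j))

  Δa-pow : ∀ p g → Δa (pow p * const g) ≈ pow p * const (A.δ g)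
  Δa-pow zero    g = begin
    Δa (1# * const g)    ≈⟨ (λ i j → *-identityˡ (const g) i (suc j)) ⟩
    Δa (const g)         ≈⟨ (λ { zero _ → ≡.refl ; (suc _) _ → ≡.refl }) ⟩
    const (A.δ g)        ≈⟨ sym {1# * const (A.δ g)} (*-identityˡ (const (A.δ g))) ⟩
    1# * const (A.δ g)   ∎
  Δa-pow (suc p) g = begin
    Δa ([1+x] * pow p * const g)      ≈⟨ (λ i j → *-assoc [1+x] (pow p) (const g) i (suc j)) ⟩
    Δa ([1+x] * (pow p * const g))    ≈⟨ Δa-1+x (pow p * const g) ⟩
    [1+x] * Δa (pow p * const g)      ≈⟨ *-congˡ {[1+x]} (Δa-pow p g) ⟩
    [1+x] * (pow p * const (A.δ g))   ≈⟨ sym {[1+x] * pow p * const (A.δ g)} (*-assoc [1+x] (pow p) (const (A.δ g))) ⟩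
    pow (suc p) * const (A.δ g)       ∎

  Δx-* : ∀ f g → Δx (f * const g) ≈ δ f * const g
  Δx-* f g = begin
    δ (f * const g)                         ≈⟨ δ-✶ f (const g) ⟩
    const (f 0) * δ (const g) + δ f * const g
      ≈⟨ +-congʳ {δ f * const g} (trans {const (f 0) * δ (const g)} (*-congˡ {const (f 0)} (λ _ _ → ≡.refl)) (zeroʳ (const (f 0)))) ⟩
    0# + δ f * const g                      ≈⟨ +-identityˡ (δ f * const g) ⟩
    δ f * const g                           ∎

  const-* : ∀ g h → const (g A.✶ h) ≈ const g * const h
  const-* g h zero    = λ _ → ≡.refl
  const-* g h (suc n) = ℤ[a].sym {(const g * const h) (suc n)}
    (ℤ[a].trans {(const g * const h) (suc n)} (X.const-✶ g (const h) (suc n)) (ℤ[a].zeroʳ g))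

  gfT : Tree → ℤ[a].Carrier
  gfT T = gf (skeleton T)

  gfT⁺ : Tree → ℤ[a].Carrier
  gfT⁺ T = gf⁺ (skeleton T)

  weight : Tree → Carrier
  weight T = pow (length (slots T)) * const (gfT T)

  -- The contribution of `R` with slot `i` to the weight of `node L R i`: the rank is the number of
  -- slots of `R` that survive above the maximum of `L`.
  slot-weight : Tree × ℕ → Carrier
  slot-weight (R , i) = pow (rank (slots R) i) * const (gfT⁺ R)

  weight-top : ∀ R → weight (top R) ≈ [1+x] * (pow (length (slots R)) * const (gfT⁺ R))
  weight-top R = begin
    [1+x] * pow p * const (A.δ 𝟙+a A.✶ gfT⁺ R)
      ≈⟨ *-congˡ {[1+x] * pow p} (λ { zero → ℤ[a].trans {A.δ 𝟙+a A.✶ gfT⁺ R}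
           (ℤ[a].*-congʳ {gfT⁺ R} {A.δ 𝟙+a} δ-1+a) (ℤ[a].*-identityˡ (gfT⁺ R)) ; (suc _) _ → ≡.refl }) ⟩
    [1+x] * pow p * const (gfT⁺ R)
      ≈⟨ *-assoc [1+x] (pow p) (const (gfT⁺ R)) ⟩
    [1+x] * (pow p * const (gfT⁺ R)) ∎
    where p = length (slots R)

  weight-node : ∀ L R i → weight (node L R i) ≈ Δa (weight L) * slot-weight (R , i)
  weight-node L R i = begin
    pow (suc (length (inner (node L R i)))) * const (A.δ (gfT L) A.✶ gfT⁺ R)
      ≈⟨ *-cong {pow (suc (length (inner (node L R i))))} {pow f * pow p} (trans (reflexive (≡.cong pow len)) (pow-+ f p))
           (const-* (A.δ (gfT L)) (gfT⁺ R)) ⟩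
    pow f * pow p * (g * e)
      ≈⟨ solve 4 (λ f p g e → f :* p :* (g :* e) := p :* g :* (f :* e)) (λ _ _ → ≡.refl) (pow f) (pow p) g e ⟩
    pow p * g * (pow f * e)
      ≈⟨ *-congʳ {pow f * e} (sym {Δa (weight L)} (Δa-pow p (gfT L))) ⟩
    Δa (weight L) * slot-weight (R , i) ∎
    where
    f = rank (slots R) i ; p = length (slots L) ; g = const (A.δ (gfT L)) ; e = const (gfT⁺ R)
    -- The trivial cut of the new shape makes up for that of `L`, which `inner L` omits.
    len : suc (length (inner (node L R i))) ≡ f ℕ.+ p
    len = ≡.trans (≡.cong suc (≡.trans
      (List.length-++ (map (size L ℕ.+_) (filter (i ≤?_) (slots R))))
      (≡.cong (ℕ._+ length (inner L)) (List.length-map (size L ℕ.+_) (filter (i ≤?_) (slots R))))))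
      (≡.sym (ℕ.+-suc f (length (inner L))))

  ∑-nodes : ∀ Ls Rs → ∑ weight (nodes Ls Rs) ≈ ∑ (Δa ∘ weight) Ls * ∑ slot-weight Rs
  ∑-nodes Ls Rs = begin
    ∑ weight (nodes Ls Rs)
      ≈⟨ ∑-cartesian weight (λ L (R , i) → node L R i) Ls Rs ⟩
    ∑ (λ L → ∑ (λ (R , i) → weight (node L R i)) Rs) Ls
      ≈⟨ ∑-cong (λ L → trans (∑-cong (λ (R , i) → weight-node L R i) Rs) (∑-*ˡ slot-weight (Δa (weight L)) Rs)) Ls ⟩
    ∑ (λ L → Δa (weight L) * ∑ slot-weight Rs) Ls
      ≈⟨ ∑-*ʳ (Δa ∘ weight) (∑ slot-weight Rs) Ls ⟩
    ∑ (Δa ∘ weight) Ls * ∑ slot-weight Rs ∎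

  ∑-convolve : ∀ n f g → ∑ weight (convolve f g n)
               ≈ ((λ k → ∑ (Δa ∘ weight) (f k)) T.✶ (λ r → ∑ slot-weight (g r))) n
  ∑-convolve zero    f g = ∑-nodes (f 0) (g 0)
  ∑-convolve (suc n) f g = begin
    ∑ weight (nodes (f 0) (g (suc n)) ++ convolve (f ∘ suc) g n)
      ≈⟨ ∑-++ weight (nodes (f 0) (g (suc n))) (convolve (f ∘ suc) g n) ⟩
    ∑ weight (nodes (f 0) (g (suc n))) + ∑ weight (convolve (f ∘ suc) g n)
      ≈⟨ +-cong (∑-nodes (f 0) (g (suc n))) (∑-convolve n (f ∘ suc) g) ⟩
    ((λ k → ∑ (Δa ∘ weight) (f k)) T.✶ (λ r → ∑ slot-weight (g r))) (suc n) ∎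

  ∑-slots : ∀ R → ∑ slot-weight (map (R ,_) (slots R)) ≈ [1+x] * (δ (pow (length (slots R))) * const (gfT⁺ R))
  ∑-slots R = begin
    ∑ slot-weight (map (R ,_) (slots R))
      ≈⟨ reflexive (∑-map slot-weight (R ,_) (slots R)) ⟩
    ∑ (λ i → pow (rank (slots R) i) * const (gfT⁺ R)) (slots R)
      ≈⟨ ∑-*ʳ (λ i → pow (rank (slots R) i)) (const (gfT⁺ R)) (slots R) ⟩
    ∑ (λ i → pow (rank (slots R) i)) (slots R) * const (gfT⁺ R)
      ≈⟨ *-congʳ {const (gfT⁺ R)} (∑-rank (slots-desc R)) ⟩
    [1+x] * δ (pow (length (slots R))) * const (gfT⁺ R)
      ≈⟨ *-assoc [1+x] (δ (pow (length (slots R)))) (const (gfT⁺ R)) ⟩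
    [1+x] * (δ (pow (length (slots R))) * const (gfT⁺ R)) ∎

  gfT⁺-nonleaf : ∀ {R n} → size R ≡ suc n → const (gfT⁺ R) ≈ [a] * const (gfT R)
  gfT⁺-nonleaf {top R}      _ = const-* A.var (gfT (top R))
  gfT⁺-nonleaf {node L R i} _ = const-* A.var (gfT (node L R i))

  [1+a]² : Carrier
  [1+a]² = [1+a] * [1+a]

  -- The coefficient of t⁰ is 0, not the weight of `leaf`, because Q ranges over nonempty
  -- permutations.
  solution : Series
  solution zero    = 0#
  solution (suc n) = ∑ weight (trees (suc n))

  -- The bracket of the middle term, times 1 + x: (1+a)² comes from the empty right part, the
  -- quotient by x from the nonempty ones.
  ∑-slotted : ∀ r → ∑ slot-weight (slotted trees r)
              ≈ [1+x] * (ν [1+a]² T.⊞ ν [a] T.✶ (Δx ∘ solution)) r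
  ∑-slotted zero = begin
    ∑ slot-weight (slotted trees 0)
      ≈⟨ ∑-concatMap slot-weight (λ R → map (R ,_) (slots R)) (trees 0) ⟩
    ∑ slot-weight (map (leaf ,_) (slots leaf)) + 0#
      ≈⟨ +-identityʳ (∑ slot-weight (map (leaf ,_) (slots leaf))) ⟩
    ∑ slot-weight (map (leaf ,_) (slots leaf))
      ≈⟨ ∑-slots leaf ⟩
    [1+x] * (δ (pow 1) * const (𝟙+a A.✶ 𝟙+a))
      ≈⟨ *-congˡ {[1+x]} (*-cong {δ (pow 1)} {1#} δ-pow-1 (const-* 𝟙+a 𝟙+a)) ⟩
    [1+x] * (1# * [1+a]²)
      ≈⟨ *-congˡ {[1+x]} (*-identityˡ [1+a]²) ⟩
    [1+x] * [1+a]²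
      ≈⟨ *-congˡ {[1+x]} (sym {[1+a]² + [a] * 0#} (trans (+-congˡ {[1+a]²} (zeroʳ [a])) (+-identityʳ [1+a]²))) ⟩
    [1+x] * ([1+a]² + [a] * 0#) ∎
    where
    δ-pow-1 : δ (pow 1) ≈ 1#
    δ-pow-1 = trans (δ-pow-suc 0) (trans (+-congˡ {1#} {[1+x] * 0#} (zeroʳ [1+x])) (+-identityʳ 1#))
  ∑-slotted (suc r) = begin
    ∑ slot-weight (slotted trees (suc r))
      ≈⟨ ∑-concatMap slot-weight (λ R → map (R ,_) (slots R)) (trees (suc r)) ⟩
    ∑ (λ R → ∑ slot-weight (map (R ,_) (slots R))) (trees (suc r))
      ≈⟨ ∑-cong-∈ (trees (suc r)) (λ {R} R∈ → term R (proj₂ (proj₁ (proj₂ (trees-enumerates (suc r))) R∈))) ⟩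
    ∑ (λ R → [1+x] * ([a] * Δx (weight R))) (trees (suc r))
      ≈⟨ trans (∑-*ˡ (λ R → [a] * Δx (weight R)) [1+x] (trees (suc r)))
           (*-congˡ {[1+x]} (∑-*ˡ (Δx ∘ weight) [a] (trees (suc r)))) ⟩
    [1+x] * ([a] * ∑ (Δx ∘ weight) (trees (suc r)))
      ≈⟨ *-congˡ {[1+x]} (*-congˡ {[a]} (sym {Δx (∑ weight (trees (suc r)))} (∑-Δx (trees (suc r))))) ⟩
    [1+x] * ([a] * Δx (solution (suc r)))
      ≈⟨ *-congˡ {[1+x]} (sym {0# + (ν [a] T.✶ (Δx ∘ solution)) (suc r)} (trans (+-identityˡ ((ν [a] T.✶ (Δx ∘ solution)) (suc r)))
           (T.const-✶ [a] (Δx ∘ solution) (suc r)))) ⟩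
    [1+x] * (ν [1+a]² T.⊞ ν [a] T.✶ (Δx ∘ solution)) (suc r) ∎
    where
    ∑-Δx : ∀ Ts → Δx (∑ weight Ts) ≈ ∑ (Δx ∘ weight) Ts
    ∑-Δx []       i j = ≡.refl
    ∑-Δx (T ∷ Ts) i j = ≡.cong (λ z → weight T (suc i) j ℤ.+ z) (∑-Δx Ts i j)
    term : ∀ R → size R ≡ suc r → ∑ slot-weight (map (R ,_) (slots R)) ≈ [1+x] * ([a] * Δx (weight R))
    term R eq = begin
      ∑ slot-weight (map (R ,_) (slots R))
        ≈⟨ ∑-slots R ⟩
      [1+x] * (d * const (gfT⁺ R))
        ≈⟨ *-congˡ {[1+x]} (*-congˡ {d} (gfT⁺-nonleaf eq)) ⟩
      [1+x] * (d * ([a] * const (gfT R)))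
        ≈⟨ solve 4 (λ x d a g → x :* (d :* (a :* g)) := x :* (a :* (d :* g))) (λ _ _ → ≡.refl) [1+x] d [a] (const (gfT R)) ⟩
      [1+x] * ([a] * (d * const (gfT R)))
        ≈⟨ *-congˡ {[1+x]} (*-congˡ {[a]} (sym {Δx (weight R)} (Δx-* (pow (length (slots R))) (gfT R)))) ⟩
      [1+x] * ([a] * Δx (weight R)) ∎
      where d = δ (pow (length (slots R)))

  ∑-top : ∀ n → ∑ weight (map top (trees (suc n))) ≈ [1+x] * ([a] * solution (suc n))
  ∑-top n = begin
    ∑ weight (map top (trees (suc n)))
      ≈⟨ reflexive (∑-map weight top (trees (suc n))) ⟩
    ∑ (weight ∘ top) (trees (suc n))
      ≈⟨ ∑-cong-∈ (trees (suc n)) (λ {R} R∈ → term R (proj₂ (proj₁ (proj₂ (trees-enumerates (suc n))) R∈))) ⟩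
    ∑ (λ R → [1+x] * ([a] * weight R)) (trees (suc n))
      ≈⟨ trans (∑-*ˡ (λ R → [a] * weight R) [1+x] (trees (suc n)))
           (*-congˡ {[1+x]} (∑-*ˡ weight [a] (trees (suc n)))) ⟩
    [1+x] * ([a] * solution (suc n)) ∎
    where
    term : ∀ R → size R ≡ suc n → weight (top R) ≈ [1+x] * ([a] * weight R)
    term R eq = begin
      weight (top R)
        ≈⟨ weight-top R ⟩
      [1+x] * (p * const (gfT⁺ R))
        ≈⟨ *-congˡ {[1+x]} (*-congˡ {p} (gfT⁺-nonleaf eq)) ⟩
      [1+x] * (p * ([a] * const (gfT R)))
        ≈⟨ solve 4 (λ x p a g → x :* (p :* (a :* g)) := x :* (a :* (p :* g))) (λ _ _ → ≡.refl) [1+x] p [a] (const (gfT R)) ⟩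
      [1+x] * ([a] * weight R) ∎
      where p = pow (length (slots R))

  ∑-Δa : ∀ Ts → ∑ (Δa ∘ weight) Ts ≈ Δa (∑ weight Ts)
  ∑-Δa []       i j = ≡.refl
  ∑-Δa (T ∷ Ts) i j = ≡.cong (λ z → weight T i (suc j) ℤ.+ z) (∑-Δa Ts i j)

  solution-kernel : ∀ n → solution (suc n) ≈ kernel solution n
  solution-kernel zero = begin
    weight (top leaf) + 0#
      ≈⟨ +-identityʳ (weight (top leaf)) ⟩
    weight (top leaf)
      ≈⟨ weight-top leaf ⟩
    [1+x] * ([1+x] * 1# * const (𝟙+a A.✶ 𝟙+a))
      ≈⟨ *-congˡ {[1+x]} (*-cong (*-identityʳ [1+x]) (const-* 𝟙+a 𝟙+a)) ⟩
    [1+x] * ([1+x] * [1+a]²)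
      ≈⟨ *-congˡ {[1+x]} (sym {[1+x] * [1+a]² + 0# * e + [a] * 0#} (trans
           (+-cong {[1+x] * [1+a]² + 0# * e} {[1+x] * [1+a]²}
             (trans (+-congˡ {[1+x] * [1+a]²} (zeroˡ e)) (+-identityʳ ([1+x] * [1+a]²))) (zeroʳ [a]))
           (+-identityʳ ([1+x] * [1+a]²)))) ⟩
    kernel solution 0 ∎
    where e = (ν [1+a]² T.⊞ ν [a] T.✶ (Δx ∘ solution)) 0
  solution-kernel (suc n) = begin
    ∑ weight (trees (suc (suc n)))
      ≈⟨ reflexive (≡.cong (∑ weight) (trees-suc (suc n))) ⟩
    ∑ weight (map top (trees (suc n)) ++ convolve (trees ∘ suc) (slotted trees) n)
      ≈⟨ ∑-++ weight (map top (trees (suc n))) (convolve (trees ∘ suc) (slotted trees) n) ⟩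
    ∑ weight (map top (trees (suc n))) + ∑ weight (convolve (trees ∘ suc) (slotted trees) n)
      ≈⟨ +-cong (∑-top n) (∑-convolve n (trees ∘ suc) (slotted trees)) ⟩
    [1+x] * ([a] * solution (suc n)) + ((λ k → ∑ (Δa ∘ weight) (trees (suc k))) T.✶ (λ r → ∑ slot-weight (slotted trees r))) n
      ≈⟨ +-congˡ {[1+x] * ([a] * solution (suc n))} conv ⟩
    [1+x] * ([a] * solution (suc n)) + [1+x] * (D T.✶ G) n
      ≈⟨ solve 3 (λ x q d → x :* q :+ x :* d := x :* (d :+ q)) (λ _ _ → ≡.refl) [1+x] ([a] * solution (suc n)) ((D T.✶ G) n) ⟩
    [1+x] * ((D T.✶ G) n + [a] * solution (suc n))
      -- Since `solution` vanishes at 0, the product of `Δa ∘ solution` with `G` at `suc n` is that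
      -- of its shift `D` with `G` at `n`.
      ≈⟨ *-congˡ {[1+x]} (+-cong
           (sym {0# + (0# * G (suc n) + (D T.✶ G) n)} (trans (+-identityˡ (0# * G (suc n) + (D T.✶ G) n))
             (trans (+-congʳ {(D T.✶ G) n} (zeroˡ (G (suc n)))) (+-identityˡ ((D T.✶ G) n)))))
           (sym {(ν [a] T.✶ solution) (suc n)} (T.const-✶ [a] solution (suc n)))) ⟩
    [1+x] * (0# + (0# * G (suc n) + (D T.✶ G) n) + (ν [a] T.✶ solution) (suc n))
      ≈⟨ sym {kernel solution (suc n)} (T.const-✶ [1+x] (ν ([1+x] * [1+a]²) T.⊞ (Δa ∘ solution) T.✶ G T.⊞ ν [a] T.✶ solution) (suc n)) ⟩
    kernel solution (suc n) ∎
    where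
    D G : Series
    D k = Δa (solution (suc k))
    G = ν [1+a]² T.⊞ ν [a] T.✶ (Δx ∘ solution)
    conv : ((λ k → ∑ (Δa ∘ weight) (trees (suc k))) T.✶ (λ r → ∑ slot-weight (slotted trees r))) n ≈ [1+x] * (D T.✶ G) n
    conv = begin
      ((λ k → ∑ (Δa ∘ weight) (trees (suc k))) T.✶ (λ r → ∑ slot-weight (slotted trees r))) n
        ≈⟨ T.✶-cong {g = λ r → ∑ slot-weight (slotted trees r)} {g′ = ν [1+x] T.✶ G} (λ k → ∑-Δa (trees (suc k)))
             (λ r → trans (∑-slotted r) (sym {(ν [1+x] T.✶ G) r} (T.const-✶ [1+x] G r))) n ⟩
      (D T.✶ (ν [1+x] T.✶ G)) n
        ≈⟨ T.✶-comm D (ν [1+x] T.✶ G) n ⟩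
      (ν [1+x] T.✶ G T.✶ D) n
        ≈⟨ T.✶-assoc (ν [1+x]) G D n ⟩
      (ν [1+x] T.✶ (G T.✶ D)) n
        ≈⟨ T.const-✶ [1+x] (G T.✶ D) n ⟩
      [1+x] * (G T.✶ D) n
        ≈⟨ *-congˡ {[1+x]} (T.✶-comm G D n) ⟩
      [1+x] * (D T.✶ G) n ∎

  solution-QEq : QEq solution
  solution-QEq = kernel-QEq (λ _ _ → ≡.refl) solution-kernel

-- Polynomiality of the coefficients

PolyA : ℤ[a].Carrier → Set
PolyA = A.Poly (λ _ → ⊤)

PolyXA : ℤ[x,a].Carrier → Set
PolyXA = X.Poly PolyA

PolyA-0 : PolyA ℤ[a].0#
PolyA-0 = A.poly (0 , λ _ _ → ≡.refl) _

PolyA-⊞ : ∀ {f g} → PolyA f → PolyA g → PolyA (f A.⊞ g)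
PolyA-⊞ = A.Poly-⊞ tt (λ _ _ → tt) (λ _ _ → tt)

PolyA-✶ : ∀ {f g} → PolyA f → PolyA g → PolyA (f A.✶ g)
PolyA-✶ = A.Poly-✶ tt (λ _ _ → tt) (λ _ _ → tt)

PolyA-const : ∀ c → PolyA (A.const c)
PolyA-const c = A.Poly-const tt (λ _ _ → tt) (λ _ _ → tt) tt

PolyA-var : PolyA A.var
PolyA-var = A.Poly-var tt (λ _ _ → tt) (λ _ _ → tt) tt

PolyA-gf : ∀ t → PolyA (gf t)
PolyA-gf⁺ : ∀ t → PolyA (gf⁺ t)
PolyA-gf leaf         = PolyA-⊞ (PolyA-const (+ 1)) PolyA-var
PolyA-gf (node l m r) = PolyA-✶ (A.Poly-δ tt (λ _ _ → tt) (λ _ _ → tt) (PolyA-gf l)) (PolyA-gf⁺ r)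
PolyA-gf⁺ leaf             = PolyA-✶ (PolyA-gf leaf) (PolyA-gf leaf)
PolyA-gf⁺ r@(node _ _ _)   = PolyA-✶ PolyA-var (PolyA-gf r)

PolyXA-pow : ∀ p → PolyXA (pow p)
PolyXA-pow zero    = X.Poly-const PolyA-0 PolyA-⊞ PolyA-✶ (PolyA-const (+ 1))
PolyXA-pow (suc p) = X.Poly-✶ PolyA-0 PolyA-⊞ PolyA-✶
  (X.Poly-⊞ PolyA-0 PolyA-⊞ PolyA-✶ (PolyXA-pow 0) (X.Poly-var PolyA-0 PolyA-⊞ PolyA-✶ (PolyA-const (+ 1))))
  (PolyXA-pow p)

PolyXA-∑ : ∀ Ts → PolyXA (∑X.∑ weight Ts)
PolyXA-∑ []       = X.poly (0 , λ _ _ _ → ≡.refl) λ _ → PolyA-0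
PolyXA-∑ (T ∷ Ts) = X.Poly-⊞ PolyA-0 PolyA-⊞ PolyA-✶
  (X.Poly-✶ PolyA-0 PolyA-⊞ PolyA-✶ (PolyXA-pow (length (slots T)))
    (X.Poly-const PolyA-0 PolyA-⊞ PolyA-✶ (PolyA-gf (skeleton T))))
  (PolyXA-∑ Ts)

-- Only finitely many coefficients in x are nonzero, so the largest of their degree bounds in a
-- serves for all of them.
PolyXA-bound : ∀ {f} → PolyXA f → ∃ λ B → ∀ i j → (B ℕ.≤ i ⊎ B ℕ.≤ j) → f i j ≡ + 0
PolyXA-bound {f} (X.poly (b , p) k) = b ℕ.⊔ degs b , bound
  where
  deg : ℕ → ℕ
  deg i = proj₁ (A.Poly.bounded (k i))
  degs : ℕ → ℕ
  degs zero    = 0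
  degs (suc n) = degs n ℕ.⊔ deg n
  deg≤degs : ∀ {n i} → i ℕ.< n → deg i ℕ.≤ degs n
  deg≤degs {suc n} {i} (s≤s i≤n) with ℕ.m≤n⇒m<n∨m≡n i≤n
  ... | inj₁ i<n    = ℕ.≤-trans (deg≤degs i<n) (ℕ.m≤m⊔n (degs n) (deg n))
  ... | inj₂ ≡.refl = ℕ.m≤n⊔m (degs n) (deg n)
  bound : ∀ i j → (b ℕ.⊔ degs b ℕ.≤ i ⊎ b ℕ.⊔ degs b ℕ.≤ j) → f i j ≡ + 0
  bound i j (inj₁ B≤i) = p i (ℕ.m⊔n≤o⇒m≤o b (degs b) B≤i) j
  bound i j (inj₂ B≤j) with b ℕ.≤? i
  ... | yes b≤i = p i b≤i j
  ... | no  b≰i = proj₂ (A.Poly.bounded (k i)) j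
    (ℕ.≤-trans (deg≤degs (ℕ.≰⇒> b≰i)) (ℕ.m⊔n≤o⇒n≤o b (degs b) B≤j))

solution-polyCoeffs : PolyCoeffs solution
solution-polyCoeffs zero    = 0 , λ _ _ _ → ≡.refl
solution-polyCoeffs (suc n) = PolyXA-bound (PolyXA-∑ (trees (suc n)))

-- At x = 0 every power of 1 + x is 1, so only the constant terms of `gf` remain.
solution-00 : ∀ n → solution (suc n) 0 0 ≡ ∑ℤ.∑ (λ T → gf (skeleton T) 0) (trees (suc n))
solution-00 n = ≡.trans (≡.cong (λ f → f 0) (∑X-coeff weight 0 (trees (suc n))))
  (≡.trans (∑A-coeff (λ T → weight T 0) 0 (trees (suc n)))
  (∑ℤ.∑-cong (λ T → ≡.trans (≡.cong (λ z → z ℤ.* gf (skeleton T) 0) (pow-0 (length (slots T)) 0))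
    (ℤ.*-identityˡ (gf (skeleton T) 0))) (trees (suc n))))

-- Stack-sorting and decreasing binary trees

inorder postorder : BT → List ℕ
inorder leaf         = []
inorder (node l m r) = inorder l ++ m ∷ inorder r
postorder leaf         = []
postorder (node l m r) = postorder l ++ postorder r ++ [ m ]

data Decreasing : BT → Set where
  leaf : Decreasing leaf
  node : ∀ {l m r} → Decreasing l → All (_< m) (inorder l) → All (_< m) (inorder r) → Decreasing r →
         Decreasing (node l m r)

maxL-≤ : ∀ {m xs} → All (_< m) xs → maxL xs ℕ.≤ m
maxL-≤ []       = z≤n
maxL-≤ (p ∷ ps) = ℕ.⊔-lub (ℕ.<⇒≤ p) (maxL-≤ ps)

maxL-split : ∀ {m xs ys} → All (_< m) xs → All (_< m) ys → maxL (xs ++ m ∷ ys) ≡ m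
maxL-split []       qs = ℕ.m≥n⇒m⊔n≡m (maxL-≤ qs)
maxL-split {m} {x ∷ xs} (p ∷ ps) qs = ≡.trans (≡.cong (x ⊔_) (maxL-split ps qs)) (ℕ.m≤n⇒m⊔n≡n (ℕ.<⇒≤ p))

splitFirst-split : ∀ {m xs ys} → All (_< m) xs → splitFirst m (xs ++ m ∷ ys) ≡ (xs , ys)
splitFirst-split {m} [] with m ℕ.≟ m
... | yes _   = refl
... | no  m≢m = contradiction refl m≢m
splitFirst-split {m} {x ∷ xs} {ys} (p ∷ ps) with x ℕ.≟ m
... | yes refl = contradiction p (ℕ.<-irrefl refl)
... | no  _ rewrite splitFirst-split {m} {xs} {ys} ps = refl

sFuel-∷ : ∀ k z zs {xs ys} → splitFirst (maxL (z ∷ zs)) (z ∷ zs) ≡ (xs , ys) →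
          sFuel (suc k) (z ∷ zs) ≡ sFuel k xs ++ sFuel k ys ++ [ maxL (z ∷ zs) ]
sFuel-∷ k z zs eq with splitFirst (maxL (z ∷ zs)) (z ∷ zs) | eq
... | _ | refl = refl

++-∷-≢[] : ∀ xs {m : ℕ} {ys} → xs ++ m ∷ ys ≢ []
++-∷-≢[] []       ()
++-∷-≢[] (_ ∷ _) ()

sFuel-split : ∀ k {m xs ys} → All (_< m) xs → All (_< m) ys →
              sFuel (suc k) (xs ++ m ∷ ys) ≡ sFuel k xs ++ sFuel k ys ++ [ m ]
sFuel-split k {m} {xs} {ys} ps qs = unfold (xs ++ m ∷ ys) refl
  where
  -- The word is generalized to `zs`, since `sFuel` computes only on a visible head.
  unfold : ∀ zs → zs ≡ xs ++ m ∷ ys → sFuel (suc k) zs ≡ sFuel k xs ++ sFuel k ys ++ [ m ]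
  unfold []       eq = contradiction (≡.sym eq) (++-∷-≢[] xs)
  unfold (z ∷ zs) eq = ≡.trans
    (sFuel-∷ k z zs {xs} {ys} (≡.trans (≡.cong₂ splitFirst max≡m eq) (splitFirst-split ps)))
    (≡.cong (λ x → sFuel k xs ++ sFuel k ys ++ [ x ]) max≡m)
    where
    max≡m : maxL (z ∷ zs) ≡ m
    max≡m = ≡.trans (≡.cong maxL eq) (maxL-split ps qs)

-- Recursive calls inherit fuel from the parent rather than the length of their own word, so any
-- sufficient fuel has to be allowed.
sFuel-inorder : ∀ k {u} → Decreasing u → length (inorder u) ℕ.≤ k → sFuel k (inorder u) ≡ postorder u
sFuel-inorder zero    leaf _ = refl
sFuel-inorder (suc k) leaf _ = refl
sFuel-inorder k {node l m r} (node dl l<m r<m dr) len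
  with k | ℕ.≤-trans (ℕ.≤-reflexive (≡.sym (≡.trans (List.length-++ (inorder l)) (ℕ.+-suc _ _)))) len
... | suc k | s≤s len′ = ≡.trans (sFuel-split k l<m r<m) (≡.cong₂ (λ a b → a ++ b ++ [ m ])
  (sFuel-inorder k dl (ℕ.m+n≤o⇒m≤o _ len′)) (sFuel-inorder k dr (ℕ.m+n≤o⇒n≤o (length (inorder l)) len′)))

stackSort-inorder : ∀ {u} → Decreasing u → stackSort (inorder u) ≡ postorder u
stackSort-inorder d = sFuel-inorder _ d ℕ.≤-refl

-- Prepends `x` to the inorder word: `x` descends the left spine past larger roots and takes the
-- remaining subtree as its right child.
insert : ℕ → BT → BT
insert x leaf = node leaf x leaf
insert x (node l m r) with x ℕ.<? m
... | yes _ = node (insert x l) m r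
... | no  _ = node leaf x (node l m r)

inorder-insert : ∀ x u → inorder (insert x u) ≡ x ∷ inorder u
inorder-insert x leaf = refl
inorder-insert x (node l m r) with x ℕ.<? m
... | yes _ = ≡.cong (_++ m ∷ inorder r) (inorder-insert x l)
... | no  _ = refl

insert-decreasing : ∀ {x u} → All (x ≢_) (inorder u) → Decreasing u → Decreasing (insert x u)
insert-decreasing x≢ leaf = node leaf [] [] leaf
insert-decreasing {x} {node l m r} x≢ d@(node dl l<m r<m dr) with x ℕ.<? m
... | yes x<m = node (insert-decreasing (All.++⁻ˡ (inorder l) x≢) dl)
  (≡.subst (All (_< m)) (≡.sym (inorder-insert x l)) (x<m ∷ l<m)) r<m dr
... | no  x≮m = node leaf [] (All.++⁺ (All.map (λ p → ℕ.<-trans p m<x) l<m) (m<x ∷ All.map (λ p → ℕ.<-trans p m<x) r<m)) d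
  where
  m<x : m < x
  m<x = ℕ.≤∧≢⇒< (ℕ.≮⇒≥ x≮m) (λ m≡x → All.head (All.++⁻ʳ (inorder l) x≢) (≡.sym m≡x))

treeOf : List ℕ → BT
treeOf []       = leaf
treeOf (x ∷ xs) = insert x (treeOf xs)

inorder-treeOf : ∀ xs → inorder (treeOf xs) ≡ xs
inorder-treeOf []       = refl
inorder-treeOf (x ∷ xs) = ≡.trans (inorder-insert x (treeOf xs)) (≡.cong (x ∷_) (inorder-treeOf xs))

treeOf-decreasing : ∀ {xs} → Unique xs → Decreasing (treeOf xs)
treeOf-decreasing []              = leaf
treeOf-decreasing {x ∷ xs} (p ∷ u) =
  insert-decreasing (≡.subst (All (x ≢_)) (≡.sym (inorder-treeOf xs)) p) (treeOf-decreasing u)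

split-unique : ∀ {m xs xs′ ys ys′} → All (_< m) xs → All (_< m) xs′ → xs ++ m ∷ ys ≡ xs′ ++ m ∷ ys′ →
               xs ≡ xs′ × ys ≡ ys′
split-unique []       []       eq = refl , List.∷-injectiveʳ eq
split-unique []       (q ∷ qs) eq with refl ← List.∷-injectiveˡ eq = contradiction q (ℕ.<-irrefl refl)
split-unique (p ∷ ps) []       eq with refl ← List.∷-injectiveˡ eq = contradiction p (ℕ.<-irrefl refl)
split-unique (p ∷ ps) (q ∷ qs) eq with refl ← List.∷-injectiveˡ eq
  with refl , refl ← split-unique ps qs (List.∷-injectiveʳ eq) = refl , refl

-- The maximum of the word is the root label, and its position separates the two subtrees.
inorder-injective : ∀ {u v} → Decreasing u → Decreasing v → inorder u ≡ inorder v → u ≡ v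
inorder-injective leaf leaf eq = refl
inorder-injective leaf (node {l} _ _ _ _) eq = contradiction (≡.sym eq) (++-∷-≢[] (inorder l))
inorder-injective (node {l} _ _ _ _) leaf eq = contradiction eq (++-∷-≢[] (inorder l))
inorder-injective (node dl l<m r<m dr) (node dl′ l<m′ r<m′ dr′) eq
  with refl ← ≡.trans (≡.sym (maxL-split l<m r<m)) (≡.trans (≡.cong maxL eq) (maxL-split l<m′ r<m′))
  with eql , eqr ← split-unique l<m l<m′ eq
  with refl ← inorder-injective dl dl′ eql | refl ← inorder-injective dr dr′ eqr = refl

postorder-↭ : ∀ u → postorder u ↭ inorder u
postorder-↭ leaf         = ↭-refl
postorder-↭ (node l m r) = ↭.++⁺ (postorder-↭ l) (↭-trans (↭.++⁺ʳ [ m ] (postorder-↭ r)) (↭-sym (↭.∷↭∷ʳ m (inorder r))))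

-- Words avoiding 231 and their cuts

infix 4 _≺_
_≺_ : List ℕ → List ℕ → Set
xs ≺ ys = All (λ x → All (x <_) ys) xs

Sorted : List ℕ → Set
Sorted = AllPairs _<_

≺-resp-↭ : ∀ {xs xs′ ys ys′} → xs ↭ xs′ → ys ↭ ys′ → xs ≺ ys → xs′ ≺ ys′
≺-resp-↭ p q = ↭.All-resp-↭ p ∘ All.map (↭.All-resp-↭ q)

≺-[]  : ∀ xs → xs ≺ []
≺-[] xs = All.universal (λ _ → []) xs

≺-++ʳ : ∀ {xs ys zs} → xs ≺ ys → xs ≺ zs → xs ≺ ys ++ zs
≺-++ʳ p q = All.zipWith (λ (a , b) → All.++⁺ a b) (p , q)

≺-++ʳ⁻ : ∀ {xs} ys {zs} → xs ≺ ys ++ zs → xs ≺ ys × xs ≺ zs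
≺-++ʳ⁻ ys p = All.map (All.++⁻ˡ ys) p , All.map (All.++⁻ʳ ys) p

≺-[-] : ∀ {xs m} → All (_< m) xs → xs ≺ [ m ]
≺-[-] = All.map (_∷ [])

Sorted-++⁻ : ∀ xs {ys} → Sorted (xs ++ ys) → Sorted xs × Sorted ys × xs ≺ ys
Sorted-++⁻ []       s       = [] , s , []
Sorted-++⁻ (x ∷ xs) (p ∷ s) with sx , sy , x≺y ← Sorted-++⁻ xs s =
  All.++⁻ˡ xs p ∷ sx , sy , All.++⁻ʳ xs p ∷ x≺y

-- The first `i` entries lie below `a` and all later ones above: with `a` in the role of 2, no 3 is
-- followed by a 1.
data SplitAt (a : ℕ) : ℕ → List ℕ → Set where
  done : ∀ {xs} → All (a <_) xs → SplitAt a 0 xs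
  step : ∀ {i x xs} → x < a → SplitAt a i xs → SplitAt a (suc i) (x ∷ xs)

-- This is pattern avoidance only for words with distinct entries.
Avoids231 : List ℕ → Set
Avoids231 []       = ⊤
Avoids231 (x ∷ xs) = ∃ (λ i → SplitAt x i xs) × Avoids231 xs

SplitAt-++⁺ : ∀ {a i} {xs ys} → SplitAt a i xs → All (a <_) ys → SplitAt a i (xs ++ ys)
SplitAt-++⁺ (done p)   q = done (All.++⁺ p q)
SplitAt-++⁺ (step p s) q = step p (SplitAt-++⁺ s q)

-- Once `m` above `a` has occurred, a later entry below `a` would complete a 231.
SplitAt-++⁻ : ∀ {a m i} xs {ys} → a < m → SplitAt a i (xs ++ m ∷ ys) → ∃ (λ j → SplitAt a j xs) × All (a <_) ys
SplitAt-++⁻ []       a<m (done (_ ∷ p)) = (0 , done []) , p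
SplitAt-++⁻ []       a<m (step m<a _)   = contradiction m<a (ℕ.<-asym a<m)
SplitAt-++⁻ (x ∷ xs) a<m (done p)       = (0 , done (All.++⁻ˡ (x ∷ xs) p)) , All.tail (All.++⁻ʳ (x ∷ xs) p)
SplitAt-++⁻ (x ∷ xs) a<m (step x<a s) with (j , t) , q ← SplitAt-++⁻ xs a<m s = (suc j , step x<a t) , q

SplitAt-below : ∀ {a xs} → All (_< a) xs → SplitAt a (length xs) xs
SplitAt-below []       = done []
SplitAt-below (p ∷ ps) = step p (SplitAt-below ps)

Avoids231-++⁺ : ∀ {m xs ys} → All (_< m) xs → Avoids231 xs → xs ≺ ys → ∃ (λ i → SplitAt m i ys) → Avoids231 ys →
                Avoids231 (xs ++ m ∷ ys)
Avoids231-++⁺ []         _             _       s b = s , b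
Avoids231-++⁺ (x<m ∷ ps) ((i , t) , a) (q ∷ qs) s b =
  (i , SplitAt-++⁺ t (x<m ∷ q)) , Avoids231-++⁺ ps a qs s b

-- An entry y of `ys` below some x of `xs` would form the pattern x, `m`, y; this forces `xs ≺ ys`.
Avoids231-++⁻ : ∀ {m xs ys} → All (_< m) xs → Avoids231 (xs ++ m ∷ ys) →
                Avoids231 xs × xs ≺ ys × ∃ (λ i → SplitAt m i ys) × Avoids231 ys
Avoids231-++⁻ []         (s , b)       = tt , [] , s , b
Avoids231-++⁻ {xs = x ∷ xs} (x<m ∷ ps) ((_ , t) , a)
  with u , q ← SplitAt-++⁻ xs x<m t | a′ , qs , s , b ← Avoids231-++⁻ ps a = (u , a′) , q ∷ qs , s , b

-- Half of Knuth's theorem that one pass sorts exactly the words avoiding 231: avoidance puts the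
-- left subtree below the right one, the order in which postorder lists them.
Sorted-postorder : ∀ {v} → Decreasing v → Avoids231 (inorder v) → Sorted (postorder v)
Sorted-postorder leaf _ = []
Sorted-postorder {node l m r} (node dl l<m r<m dr) a
  with al , l≺r , _ , ar ← Avoids231-++⁻ l<m a =
  AllPairs.++⁺ (Sorted-postorder dl al)
    (AllPairs.++⁺ (Sorted-postorder dr ar) ([] ∷ []) (≺-[-] (↭.All-resp-↭ (↭-sym (postorder-↭ r)) r<m)))
    (≺-++ʳ (≺-resp-↭ (↭-sym (postorder-↭ l)) (↭-sym (postorder-↭ r)) l≺r)
      (≺-[-] (↭.All-resp-↭ (↭-sym (postorder-↭ l)) l<m)))

-- The other half of Knuth's theorem. The root exceeds its right subtree, so it splits that word at
-- full length.
postorder-avoids : ∀ {v} → Decreasing v → Sorted (postorder v) → Avoids231 (inorder v)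
postorder-avoids leaf _ = tt
postorder-avoids {node l m r} (node dl l<m r<m dr) s
  with sl , s′ , l≺ ← Sorted-++⁻ (postorder l) s
  with sr , _ , _ ← Sorted-++⁻ (postorder r) s′ =
  Avoids231-++⁺ l<m (postorder-avoids dl sl)
    (≺-resp-↭ (postorder-↭ l) (postorder-↭ r) (proj₁ (≺-++ʳ⁻ (postorder r) l≺)))
    (_ , SplitAt-below r<m) (postorder-avoids dr sr)

-- The first `i` entries lie below all others, so the word is a direct sum; the trivial cuts 0 and
-- `length xs` are included.
data Cut : ℕ → List ℕ → Set where
  zero : ∀ {xs} → Cut 0 xs
  suc  : ∀ {i x xs} → All (x <_) (drop i xs) → Cut i xs → Cut (suc i) (x ∷ xs)

Cut-≤ : ∀ {i xs} → Cut i xs → i ℕ.≤ length xs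
Cut-≤ zero      = z≤n
Cut-≤ (suc _ c) = s≤s (Cut-≤ c)

drop-++-≤ : ∀ {j} xs {ys : List ℕ} → j ℕ.≤ length xs → drop j (xs ++ ys) ≡ drop j xs ++ ys
drop-++-≤ {zero}  xs       _       = refl
drop-++-≤ {suc j} (x ∷ xs) (s≤s p) = drop-++-≤ xs p

drop-++-+ : ∀ (xs : List ℕ) {ys} j → drop (length xs ℕ.+ j) (xs ++ ys) ≡ drop j ys
drop-++-+ []       j = refl
drop-++-+ (x ∷ xs) j = drop-++-+ xs j

Cut-++⁻ : ∀ {m j} xs {ys} → Cut j (xs ++ m ∷ ys) →
          (j ℕ.≤ length xs × Cut j xs) ⊎ ∃ λ k → j ≡ suc (length xs) ℕ.+ k × All (m <_) (drop k ys) × Cut k ys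
Cut-++⁻ {j = zero} xs _ = inj₁ (z≤n , zero)
Cut-++⁻ {j = suc j} [] (suc p c) = inj₂ (_ , refl , p , c)
Cut-++⁻ {j = suc j} (x ∷ xs) (suc p c) with Cut-++⁻ xs c
... | inj₁ (j≤ , c′) = inj₁ (s≤s j≤ , suc (All.++⁻ˡ (drop j xs) (≡.subst (All (x <_)) (drop-++-≤ xs j≤) p)) c′)
... | inj₂ (k , eq , q , c′) = inj₂ (k , ≡.cong suc eq , q , c′)

Cut-++⁺ˡ : ∀ {m j xs ys} → All (_< m) xs → xs ≺ ys → Cut j xs → Cut j (xs ++ m ∷ ys)
Cut-++⁺ˡ xs<m       xs≺ys    zero      = zero
Cut-++⁺ˡ {xs = x ∷ xs} (x<m ∷ xs<m) (q ∷ qs) (suc p c) =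
  suc (≡.subst (All (x <_)) (≡.sym (drop-++-≤ xs (Cut-≤ c))) (All.++⁺ p (x<m ∷ q))) (Cut-++⁺ˡ xs<m qs c)

Cut-++⁺ʳ : ∀ {m k xs ys} → xs ≺ ys → All (m <_) (drop k ys) → Cut k ys → Cut (suc (length xs) ℕ.+ k) (xs ++ m ∷ ys)
Cut-++⁺ʳ []       p c = suc p c
Cut-++⁺ʳ {m} {k} {x ∷ xs} {ys} (q ∷ qs) p c = suc
  (≡.subst (All (x <_)) (≡.sym (≡.trans (≡.cong (λ n → drop n (xs ++ m ∷ ys)) (≡.sym (ℕ.+-suc (length xs) k)))
    (drop-++-+ xs (suc k)))) (All.drop⁺ k q))
  (Cut-++⁺ʳ qs p c)

Cut-∷ʳ⁻ : ∀ {m j} xs → Cut j (xs ++ [ m ]) → Cut j xs ⊎ j ≡ suc (length xs)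
Cut-∷ʳ⁻ xs c with Cut-++⁻ xs c
... | inj₁ (_ , c′)           = inj₁ c′
... | inj₂ (_ , eq , _ , zero) = inj₂ (≡.trans eq (ℕ.+-identityʳ _))

Cut-∷ʳ⁺ : ∀ {m} xs → Cut (suc (length xs)) (xs ++ [ m ])
Cut-∷ʳ⁺ {m} xs = ≡.subst (λ j → Cut j (xs ++ [ m ])) (ℕ.+-identityʳ _) (Cut-++⁺ʳ (≺-[] xs) [] zero)

-- With its converse below: everything behind position `j` exceeds `m` exactly when `i ≤ j`. This is
-- the filter in `inner`.
SplitAt-drop⁺ : ∀ {m i j xs} → SplitAt m i xs → i ℕ.≤ j → All (m <_) (drop j xs)
SplitAt-drop⁺ {j = j} (done p) _       = All.drop⁺ j p
SplitAt-drop⁺ (step _ s)       (s≤s q) = SplitAt-drop⁺ s q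

SplitAt-drop⁻ : ∀ {m i j xs} → SplitAt m i xs → All (m <_) (drop j xs) → i ℕ.≤ j
SplitAt-drop⁻             (done _)     _         = z≤n
SplitAt-drop⁻ {j = zero}  (step x<m _) (m<x ∷ _) = contradiction m<x (ℕ.<-asym x<m)
SplitAt-drop⁻ {j = suc j} (step _ s)   p         = s≤s (SplitAt-drop⁻ s p)

-- By transitivity through `m`: avoidance forces `m`, in value, into a gap between components.
SplitAt-Cut : ∀ {m i xs} → SplitAt m i xs → Cut i xs
SplitAt-Cut (done _)     = zero
SplitAt-Cut (step x<m s) = suc (All.map (ℕ.<-trans x<m) (SplitAt-drop⁺ s ℕ.≤-refl)) (SplitAt-Cut s)

below : ℕ → List ℕ → ℕ
below m xs = length (filter (ℕ._<? m) xs)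

below-↭ : ∀ {m xs ys} → xs ↭ ys → below m xs ≡ below m ys
below-↭ {m} p = ↭.↭-length (↭.filter-↭ (ℕ._<? m) p)

below-++ : ∀ {m} xs {ys} → All (_< m) xs → All (m <_) ys → below m (xs ++ ys) ≡ length xs
below-++ {m} xs {ys} p q = ≡.cong length (≡.trans (List.filter-++ (ℕ._<? m) xs ys)
  (≡.trans (≡.cong₂ _++_ (List.filter-all (ℕ._<? m) p) (List.filter-none (ℕ._<? m) (All.map ℕ.<-asym q)))
    (List.++-identityʳ xs)))

below-drop : ∀ {m} i xs → All (m <_) (drop i xs) → below m xs ℕ.≤ i
below-drop {m} zero    xs       p = ℕ.≤-reflexive (≡.cong length (List.filter-none (ℕ._<? m) (All.map ℕ.<-asym p)))
below-drop     (suc i) []       p = z≤n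
below-drop {m} (suc i) (x ∷ xs) p with x ℕ.<? m
... | yes x<m rewrite List.filter-accept (ℕ._<? m) {x} {xs} x<m = s≤s (below-drop i xs p)
... | no  x≮m rewrite List.filter-reject (ℕ._<? m) {x} {xs} x≮m = ℕ.m≤n⇒m≤1+n (below-drop i xs p)

below-zero : ∀ {m} xs → All (m ≢_) xs → below m xs ≡ 0 → All (m <_) xs
below-zero []       _        _  = []
below-zero {m} (x ∷ xs) (m≢x ∷ ps) eq with x ℕ.<? m
... | yes x<m rewrite List.filter-accept (ℕ._<? m) {x} {xs} x<m with () ← eq
... | no  x≮m rewrite List.filter-reject (ℕ._<? m) {x} {xs} x≮m = ℕ.≤∧≢⇒< (ℕ.≮⇒≥ x≮m) m≢x ∷ below-zero xs ps eq

-- If an entry before the cut exceeded `m`, so would everything behind the cut, leaving too few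
-- entries below `m`.
Cut-SplitAt : ∀ {m i xs} → Cut i xs → All (m ≢_) xs → below m xs ≡ i → SplitAt m i xs
Cut-SplitAt {xs = xs} zero m∉ eq = done (below-zero xs m∉ eq)
Cut-SplitAt {m} {suc i} {x ∷ xs} (suc p c) (m≢x ∷ m∉) eq with x ℕ.<? m
... | yes x<m rewrite List.filter-accept (ℕ._<? m) {x} {xs} x<m = step x<m (Cut-SplitAt c m∉ (ℕ.suc-injective eq))
... | no  x≮m rewrite List.filter-reject (ℕ._<? m) {x} {xs} x≮m = contradiction
  (below-drop i xs (All.map (ℕ.<-trans (ℕ.≤∧≢⇒< (ℕ.≮⇒≥ x≮m) m≢x)) p))
  (ℕ.<⇒≱ (ℕ.≤-reflexive (≡.sym eq)))

-- Permutations whose image avoids 231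

Sorted-∷-min : ∀ {v V x} → Sorted (v ∷ V) → x ∈ v ∷ V → v ℕ.≤ x
Sorted-∷-min _       (here refl) = ℕ.≤-refl
Sorted-∷-min (p ∷ _) (there x∈)  = ℕ.<⇒≤ (All.lookup p x∈)

-- The least entry `v` of `V` cannot lie in `ys`, which is above the nonempty `xs`; it is removed
-- from `xs`, and the induction goes on with the tail of `V`.
Sorted-split : ∀ {V} xs {ys} → Sorted V → V ↭ xs ++ ys → xs ≺ ys → ∃₂ λ V₁ V₂ → V ≡ V₁ ++ V₂ × V₁ ↭ xs × V₂ ↭ ys
Sorted-split {V} [] s V↭ _ = [] , V , refl , ↭-refl , V↭
Sorted-split {[]} (x ∷ xs) s V↭ _ = contradiction (↭-sym V↭) ↭.¬x∷xs↭[]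
Sorted-split {v ∷ V} xs@(x ∷ _) {ys} s@(_ ∷ s′) V↭ xs≺ys with ∈.∈-++⁻ xs (↭.∈-resp-↭ V↭ (here refl))
... | inj₂ v∈ys = contradiction (All.lookup (All.head xs≺ys) v∈ys)
                    (ℕ.≤⇒≯ (Sorted-∷-min s (↭.∈-resp-↭ (↭-sym V↭) (here refl))))
... | inj₁ v∈xs with zs , ws , eq ← ∈.∈-∃++ v∈xs
    with V₁ , V₂ , refl , p , q ← Sorted-split (zs ++ ws) s′
           (↭-trans
             (↭.drop-mid [] zs (↭-trans V↭ (↭-reflexive (≡.trans (≡.cong (_++ ys) eq) (List.++-assoc zs (v ∷ ws) ys)))))
             (↭-reflexive (≡.sym (List.++-assoc zs ws ys))))
           (let a , b = All.++⁻ zs (≡.subst (_≺ ys) eq xs≺ys) in All.++⁺ a (All.tail b))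
    = v ∷ V₁ , V₂ , refl , ↭-trans (↭.prep v p) (↭-trans (↭-sym (↭.shift v zs ws)) (↭-reflexive (≡.sym eq))) , q

Sorted-last : ∀ {V} xs {n ys} → Sorted V → V ↭ xs ++ n ∷ ys → All (_< n) xs → All (_< n) ys →
              ∃ λ V′ → V ≡ V′ ++ [ n ] × V′ ↭ xs ++ ys
Sorted-last xs {n} {ys} s V↭ xs<n ys<n with V₁ , V₂ , refl , p , q ←
  Sorted-split (xs ++ ys) s (↭-trans V↭ (↭-trans (↭.++⁺ˡ xs (↭.∷↭∷ʳ n ys)) (↭-reflexive (≡.sym (List.++-assoc xs ys [ n ])))))
    (≺-[-] (All.++⁺ xs<n ys<n))
  with refl ← ↭.↭-singleton-inv q = V₁ , refl , p

-- The default 0 never arises for lists of the length that `realize` expects.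
head₀ : List ℕ → ℕ
head₀ []      = 0
head₀ (x ∷ _) = x

-- For V = V₁ ++ V₂ ++ m ∷ V₃ ++ [ n ] with |V₁| = |L| - 1 and |V₂| = i, the left subtree of the
-- root n is realized on V₁ ++ [ m ] and the right one on V₂ ++ V₃.
realize : Tree → List ℕ → BT
realize leaf         V = leaf
realize (top R)      V = node leaf (head₀ (drop (size R) V)) (realize R (take (size R) V))
realize (node L R i) V =
  let k = pred (size L)
      W = drop k V
      Z = drop i W
      Y = drop 1 Z
      j = size R ∸ i
  in node (realize L (take k V ++ take 1 Z)) (head₀ (drop j Y)) (realize R (take i W ++ take j Y))

take-++ : ∀ {k} (xs : List ℕ) {ys} → length xs ≡ k → take k (xs ++ ys) ≡ xs
take-++ []       refl = refl
take-++ (x ∷ xs) refl = ≡.cong (x ∷_) (take-++ xs refl)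

drop-++ : ∀ {k} (xs : List ℕ) {ys} → length xs ≡ k → drop k (xs ++ ys) ≡ ys
drop-++ []       refl = refl
drop-++ (x ∷ xs) refl = drop-++ xs refl

realize-top : ∀ R {V n} → length V ≡ size R → realize (top R) (V ++ [ n ]) ≡ node leaf n (realize R V)
realize-top R {V} {n} eq = ≡.cong₂ (λ a b → node leaf (head₀ a) (realize R b)) (drop-++ V eq) (take-++ V eq)

realize-node : ∀ L R i V₁ V₂ m V₃ n → length V₁ ≡ pred (size L) → length V₂ ≡ i → length V₃ ≡ size R ∸ i →
  realize (node L R i) (V₁ ++ V₂ ++ m ∷ V₃ ++ [ n ]) ≡ node (realize L (V₁ ++ [ m ])) n (realize R (V₂ ++ V₃))
realize-node L R i V₁ V₂ m V₃ n e₁ e₂ e₃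
  rewrite take-++ V₁ {V₂ ++ m ∷ V₃ ++ [ n ]} e₁ | drop-++ V₁ {V₂ ++ m ∷ V₃ ++ [ n ]} e₁
        | take-++ V₂ {m ∷ V₃ ++ [ n ]} e₂ | drop-++ V₂ {m ∷ V₃ ++ [ n ]} e₂
        | take-++ V₃ {[ n ]} e₃ | drop-++ V₃ {[ n ]} e₃ = refl

-- The slot is read off as the number of entries of the right subtree below the root of the left
-- one, which is its maximum in a decreasing tree.
decode : BT → Tree
decode leaf                         = leaf
decode (node leaf n r)              = top (decode r)
decode (node l@(node _ m _) n r) = node (decode l) (decode r) (below m (inorder r))

splitLength : ∀ k {j} (V : List ℕ) → length V ≡ k ℕ.+ j → ∃₂ λ V₁ V₂ → V ≡ V₁ ++ V₂ × length V₁ ≡ k × length V₂ ≡ j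
splitLength zero    V       eq = [] , V , refl , refl , eq
splitLength (suc k) (x ∷ V) eq with V₁ , V₂ , refl , e₁ , e₂ ← splitLength k V (ℕ.suc-injective eq) =
  x ∷ V₁ , V₂ , refl , ≡.cong suc e₁ , e₂

slot≤size : ∀ {T i} → i ∈ slots T → i ℕ.≤ size T
slot≤size     (here refl) = ℕ.≤-refl
slot≤size {T} (there p)   = ℕ.<⇒≤ (All.lookup (inner-< T) p)

-- By Knuth's theorem these are the decreasing trees of the 2-stack-sortable words on `V`.
record W₂ (V : List ℕ) (t : BT) : Set where
  constructor w₂
  field
    decreasing : Decreasing t
    entries    : inorder t ↭ V
    avoids     : Avoids231 (postorder t)

-- The exact match of slots and cuts strengthens the induction: a `node` needs its slot to be a cut
-- of the image of `R`.
record Realizes (T : Tree) (V : List ℕ) (t : BT) : Set where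
  constructor realizes
  field
    isW₂    : W₂ V t
    decodes : decode t ≡ T
    cuts    : ∀ {j} → j ∈ slots T → Cut j (postorder t)
    cuts⁻   : ∀ {j} → Cut j (postorder t) → j ∈ slots T

size≡length-postorder : ∀ {T V t} → Realizes T V t → length V ≡ size T → length (postorder t) ≡ size T
size≡length-postorder {t = t} (realizes (w₂ _ p _) _ _ _) eq =
  ≡.trans (↭.↭-length (↭-trans (postorder-↭ t) p)) eq

Realizes-top : ∀ {R V n r} → length V ≡ size R → All (_< n) V → Realizes R V r →
               Realizes (top R) (V ++ [ n ]) (node leaf n r)
Realizes-top {R} {V} {n} {r} len V<n e@(realizes (w₂ d p a) dec cut cut⁻) = realizes
  (w₂ (node leaf [] r<n d) (↭-trans (↭.prep n p) (↭.∷↭∷ʳ n V))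
    (Avoids231-++⁺ (↭.All-resp-↭ (↭-sym (postorder-↭ r)) r<n) a (≺-[] _) (0 , done []) tt))
  (≡.cong top dec) cut′ cut⁻′
  where
  r<n : All (_< n) (inorder r)
  r<n = ↭.All-resp-↭ (↭-sym p) V<n
  len′ : length (postorder r) ≡ size R
  len′ = size≡length-postorder e len
  cut′ : ∀ {j} → j ∈ slots (top R) → Cut j (postorder r ++ [ n ])
  cut′ (here refl) = ≡.subst (λ k → Cut (suc k) (postorder r ++ [ n ])) len′ (Cut-∷ʳ⁺ (postorder r))
  cut′ (there q)   = Cut-++⁺ˡ (↭.All-resp-↭ (↭-sym (postorder-↭ r)) r<n) (≺-[] _) (cut q)
  cut⁻′ : ∀ {j} → Cut j (postorder r ++ [ n ]) → j ∈ slots (top R)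
  cut⁻′ c with Cut-∷ʳ⁻ (postorder r) c
  ... | inj₁ c′ = there (cut⁻ c′)
  ... | inj₂ eq = here (≡.trans eq (≡.cong suc len′))

-- Both `m′` and `m` are the maximum of the same entries.
root : ∀ {V₁ m ll m′ lr} → All (_< m) V₁ → Decreasing (node ll m′ lr) → inorder (node ll m′ lr) ↭ V₁ ++ [ m ] →
       m′ ≡ m × inorder ll ++ inorder lr ↭ V₁
root {V₁} {m} {ll} {m′} {lr} V₁<m (node _ ll<m′ lr<m′ _) p
  with refl ← ℕ.≤-antisym
    (All.lookup (All.++⁺ (All.map ℕ.<⇒≤ V₁<m) (ℕ.≤-refl ∷ [])) (↭.∈-resp-↭ p (∈.∈-++⁺ʳ (inorder ll) (here refl))))
    (All.lookup (All.++⁺ (All.map ℕ.<⇒≤ ll<m′) (ℕ.≤-refl ∷ All.map ℕ.<⇒≤ lr<m′))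
      (↭.∈-resp-↭ (↭-sym p) (∈.∈-++⁺ʳ V₁ (here refl))))
  = refl , ↭-trans (↭.drop-mid (inorder ll) V₁ p) (↭-reflexive (List.++-identityʳ V₁))

module _ {V₁ V₂ : List ℕ} {m : ℕ} {V₃ : List ℕ} {n : ℕ} (s : Sorted (V₁ ++ V₂ ++ m ∷ V₃ ++ [ n ])) where
  private
    s₁ = Sorted-++⁻ V₁ s
    s₂ = Sorted-++⁻ V₂ (proj₁ (proj₂ s₁))
    s₃ = Sorted-++⁻ V₃ (AllPairs.tail (proj₁ (proj₂ s₂)))
    V₁≺ = ≺-++ʳ⁻ V₂ (proj₂ (proj₂ s₁))
    V₁≺′ = ≺-++ʳ⁻ V₃ (All.map All.tail (proj₂ V₁≺))
    V₂≺′ = ≺-++ʳ⁻ V₃ (All.map All.tail (proj₂ (proj₂ s₂)))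
    m< : All (m <_) (V₃ ++ [ n ])
    m< = AllPairs.head (proj₁ (proj₂ s₂))

  V₁<m : All (_< m) V₁
  V₁<m = All.map All.head (proj₂ V₁≺)

  V₂<m : All (_< m) V₂
  V₂<m = All.map All.head (proj₂ (proj₂ s₂))

  m<V₃ : All (m <_) V₃
  m<V₃ = All.++⁻ˡ V₃ m<

  m<n : m < n
  m<n = All.head (All.++⁻ʳ V₃ m<)

  V₁≺V₂V₃ : V₁ ≺ V₂ ++ V₃
  V₁≺V₂V₃ = ≺-++ʳ (proj₁ V₁≺) (proj₁ V₁≺′)

  V₁m<n : All (_< n) (V₁ ++ [ m ])
  V₁m<n = All.++⁺ (All.map All.head (proj₂ V₁≺′)) (m<n ∷ [])

  V₂V₃<n : All (_< n) (V₂ ++ V₃)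
  V₂V₃<n = All.++⁺ (All.map All.head (proj₂ V₂≺′)) (All.map All.head (proj₂ (proj₂ s₃)))

  Sorted-V₁m : Sorted (V₁ ++ [ m ])
  Sorted-V₁m = AllPairs.++⁺ (proj₁ s₁) ([] ∷ []) (≺-[-] V₁<m)

  Sorted-V₂V₃ : Sorted (V₂ ++ V₃)
  Sorted-V₂V₃ = AllPairs.++⁺ (proj₁ s₂) (proj₁ s₃) (proj₁ V₂≺′)

  entries-↭ : (V₁ ++ [ m ]) ++ n ∷ V₂ ++ V₃ ↭ V₁ ++ V₂ ++ m ∷ V₃ ++ [ n ]
  entries-↭ = ↭-trans (↭-reflexive (List.++-assoc V₁ [ m ] (n ∷ V₂ ++ V₃))) (↭.++⁺ˡ V₁
    (↭-trans (↭.prep m (↭-trans (↭.∷↭∷ʳ n (V₂ ++ V₃)) (↭-reflexive (List.++-assoc V₂ V₃ [ n ]))))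
             (↭-sym (↭.shift m V₂ (V₃ ++ [ n ])))))

  -- The image is λ′ m ρ n. As `i` is a cut of ρ and exactly `i` entries of ρ are below `m`,
  -- `Cut-SplitAt` yields avoidance; a cut behind `m` must come from a cut of ρ n at or above `i`.
  Realizes-node : ∀ {L R i l r} → length (V₁ ++ [ m ]) ≡ size L → length (V₂ ++ V₃) ≡ size R → length V₂ ≡ i →
    0 < size L → i ∈ slots R → Realizes L (V₁ ++ [ m ]) l → Realizes R (V₂ ++ V₃) r →
    Realizes (node L R i) (V₁ ++ V₂ ++ m ∷ V₃ ++ [ n ]) (node l n r)
  Realizes-node {l = leaf} _ _ _ pos _ (realizes _ refl _ _) _ = contradiction pos λ ()
  Realizes-node {L} {R} {i} {l@(node ll m′ lr)} {r} lenL lenR len₂ pos i∈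
    eL@(realizes (w₂ dl pl al) decL cutL cutL⁻) eR@(realizes (w₂ dr pr ar) decR cutR cutR⁻)
    with refl , pl′ ← root V₁<m dl pl = realizes
      (w₂ (node dl (↭.All-resp-↭ (↭-sym pl) V₁m<n) r<n dr)
          (↭-trans (↭.++⁺ pl (↭.prep n pr)) entries-↭)
          (≡.subst Avoids231 (≡.sym post≡) (Avoids231-++⁺ λ<m (proj₁ (Avoids231-++⁻ λ<m al′)) λ≺ (_ , split)
            (Avoids231-++⁺ ρ<n ar (≺-[] ρ) (0 , done []) tt))))
      (≡.trans (≡.cong (node (decode l) (decode r)) below-r)
        (≡.cong₂ (λ a b → node a b i) decL decR))
      (λ {j} j∈ → ≡.subst (Cut j) (≡.sym post≡) (cut j∈))
      (λ {j} c → cut⁻ (≡.subst (Cut j) post≡ c))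
    where
    λ′ ρ : List ℕ
    λ′ = postorder ll ++ postorder lr
    ρ = postorder r
    λ↭ : λ′ ↭ V₁
    λ↭ = ↭-trans (↭.++⁺ (postorder-↭ ll) (postorder-↭ lr)) pl′
    ρ↭ : ρ ↭ V₂ ++ V₃
    ρ↭ = ↭-trans (postorder-↭ r) pr
    post-l : postorder l ≡ λ′ ++ [ m ]
    post-l = ≡.sym (List.++-assoc (postorder ll) (postorder lr) [ m ])
    post≡ : postorder (node l n r) ≡ λ′ ++ m ∷ ρ ++ [ n ]
    post≡ = ≡.trans (≡.cong (_++ ρ ++ [ n ]) post-l) (List.++-assoc λ′ [ m ] (ρ ++ [ n ]))
    al′ : Avoids231 (λ′ ++ [ m ])
    al′ = ≡.subst Avoids231 post-l al
    r<n : All (_< n) (inorder r)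
    r<n = ↭.All-resp-↭ (↭-sym pr) V₂V₃<n
    ρ<n : All (_< n) ρ
    ρ<n = ↭.All-resp-↭ (↭-sym ρ↭) V₂V₃<n
    λ<m : All (_< m) λ′
    λ<m = ↭.All-resp-↭ (↭-sym λ↭) V₁<m
    λ≺ : λ′ ≺ ρ ++ [ n ]
    λ≺ = ≺-++ʳ (≺-resp-↭ (↭-sym λ↭) (↭-sym ρ↭) V₁≺V₂V₃)
               (≺-[-] (All.map (λ p → ℕ.<-trans p m<n) λ<m))
    below-V : below m (V₂ ++ V₃) ≡ i
    below-V = ≡.trans (below-++ V₂ V₂<m m<V₃) len₂
    below-r : below m (inorder r) ≡ i
    below-r = ≡.trans (below-↭ pr) below-V
    split : SplitAt m i (ρ ++ [ n ])
    split = SplitAt-++⁺ (Cut-SplitAt (cutR i∈)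
      (↭.All-resp-↭ (↭-sym ρ↭) (All.++⁺ (All.map (λ p → ℕ.>⇒≢ p) V₂<m) (All.map (λ p → ℕ.<⇒≢ p) m<V₃)))
      (≡.trans (below-↭ ρ↭) below-V)) (m<n ∷ [])
    lenλ : suc (length λ′) ≡ size L
    lenλ = ≡.trans (≡.trans (≡.sym (ℕ.+-comm (length λ′) 1)) (≡.sym (List.length-++ λ′)))
      (≡.trans (≡.cong length (≡.sym post-l)) (size≡length-postorder eL lenL))
    lenρ : length ρ ≡ size R
    lenρ = size≡length-postorder eR lenR
    cut : ∀ {j} → j ∈ slots (node L R i) → Cut j (λ′ ++ m ∷ ρ ++ [ n ])
    cut (here refl) = ≡.subst (λ j → Cut j (λ′ ++ m ∷ ρ ++ [ n ])) (≡.trans (ℕ.+-suc (suc (length λ′)) (length ρ))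
        (≡.cong₂ (λ a b → suc (a ℕ.+ b)) lenλ lenρ))
      (Cut-++⁺ʳ λ≺ (SplitAt-drop⁺ split (ℕ.m≤n⇒m≤1+n (≡.subst (i ℕ.≤_) (≡.sym lenρ) (slot≤size i∈)))) (Cut-∷ʳ⁺ ρ))
    cut {j} (there j∈) with ∈.∈-++⁻ (map (size L ℕ.+_) (filter (i ≤?_) (slots R))) j∈
    ... | inj₁ q with k , k∈ , refl ← ∈.∈-map⁻ (size L ℕ.+_) q
                 with k∈R , i≤k ← ∈.∈-filter⁻ (i ≤?_) {xs = slots R} k∈
        = ≡.subst (λ a → Cut (a ℕ.+ k) (λ′ ++ m ∷ ρ ++ [ n ])) lenλ
            (Cut-++⁺ʳ λ≺ (SplitAt-drop⁺ split i≤k) (Cut-++⁺ˡ ρ<n (≺-[] ρ) (cutR k∈R)))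
    ... | inj₂ q with Cut-∷ʳ⁻ λ′ (≡.subst (Cut j) post-l (cutL (there q)))
    ...   | inj₁ c    = Cut-++⁺ˡ λ<m λ≺ c
    -- This would be the trivial cut of `L`, which `inner L` omits.
    ...   | inj₂ refl = contradiction (≡.subst (_< size L) lenλ (All.lookup (inner-< L) q)) (ℕ.<-irrefl refl)
    cut⁻ : ∀ {j} → Cut j (λ′ ++ m ∷ ρ ++ [ n ]) → j ∈ slots (node L R i)
    cut⁻ {j} c with Cut-++⁻ λ′ c
    ... | inj₁ (j≤ , c′) with cutL⁻ (≡.subst (Cut j) (≡.sym post-l) (Cut-++⁺ˡ λ<m (≺-[] λ′) c′))
    ...   | here refl = contradiction (≡.subst (ℕ._≤ length λ′) (≡.sym lenλ) j≤) (ℕ.<-irrefl refl)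
    ...   | there q   = there (∈.∈-++⁺ʳ (map (size L ℕ.+_) (filter (i ≤?_) (slots R))) q)
    cut⁻ c | inj₂ (k , refl , p , c′) with Cut-∷ʳ⁻ ρ c′
    ...   | inj₁ c″   = there (∈.∈-++⁺ˡ (≡.subst (λ a → a ℕ.+ k ∈ map (size L ℕ.+_) (filter (i ≤?_) (slots R))) (≡.sym lenλ)
                          (∈.∈-map⁺ (size L ℕ.+_) (∈.∈-filter⁺ (i ≤?_) (cutR⁻ c″) (SplitAt-drop⁻ split p)))))
    ...   | inj₂ refl = here (≡.trans (ℕ.+-suc (suc (length λ′)) (length ρ))
                          (≡.cong₂ (λ a b → suc (a ℕ.+ b)) lenλ lenρ))

realize-sound : ∀ T {V} → Valid T → Sorted V → length V ≡ size T → Realizes T V (realize T V)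
realize-sound leaf {[]} _ _ _ = realizes (w₂ leaf ↭-refl tt) refl (λ { (here refl) → zero }) λ { zero → here refl }
realize-sound (top R) {V} v s eq
  with V′ , (n ∷ []) , refl , len , _ ← splitLength (size R) V (≡.trans eq (ℕ.+-comm 1 (size R)))
  with s′ , _ , V′≺n ← Sorted-++⁻ V′ s
  = ≡.subst (Realizes (top R) (V′ ++ [ n ])) (≡.sym (realize-top R len))
      (Realizes-top len (All.map All.head V′≺n) (realize-sound R v s′ len))
realize-sound (node L R i) {V} (vL , pos , vR , i∈) s eq = build (slot≤size i∈) (ℕ.suc-pred (size L) {{ℕ.>-nonZero pos}})
  where
  build : i ℕ.≤ size R → suc (pred (size L)) ≡ size L → Realizes (node L R i) V (realize (node L R i) V)
  build i≤ sucpred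
    with V₁ , W , refl , e₁ , eW ← splitLength (pred (size L)) {suc (suc (size R))} V
           (≡.trans eq (≡.trans (≡.cong (λ a → suc (a ℕ.+ size R)) (≡.sym sucpred))
             (≡.sym (≡.trans (ℕ.+-suc (pred (size L)) (suc (size R))) (≡.cong suc (ℕ.+-suc (pred (size L)) (size R)))))))
    with V₂ , (m ∷ Y) , refl , e₂ , eY ← splitLength i {suc (suc (size R ∸ i))} W
           (≡.trans eW (≡.sym (≡.trans (ℕ.+-suc i (suc (size R ∸ i))) (≡.cong suc (≡.trans (ℕ.+-suc i (size R ∸ i))
             (≡.cong suc (ℕ.m+[n∸m]≡n i≤)))))))
    with V₃ , (n ∷ []) , refl , e₃ , _ ← splitLength (size R ∸ i) Y
           (≡.trans (ℕ.suc-injective eY) (ℕ.+-comm 1 (size R ∸ i)))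
    = ≡.subst (Realizes (node L R i) _) (≡.sym (realize-node L R i V₁ V₂ m V₃ n e₁ e₂ e₃))
        (Realizes-node s lenL lenR e₂ pos i∈
          (realize-sound L vL (Sorted-V₁m {V₂ = V₂} {V₃ = V₃} s) lenL)
          (realize-sound R vR (Sorted-V₂V₃ {V₁ = V₁} s) lenR))
    where
    lenL : length (V₁ ++ [ m ]) ≡ size L
    lenL = ≡.trans (List.length-++ V₁) (≡.trans (ℕ.+-comm (length V₁) 1) (≡.trans (≡.cong suc e₁) sucpred))
    lenR : length (V₂ ++ V₃) ≡ size R
    lenR = ≡.trans (List.length-++ V₂) (≡.trans (≡.cong₂ ℕ._+_ e₂ e₃) (ℕ.m+[n∸m]≡n i≤))

SplitAt-++ : ∀ {a i xs} → SplitAt a i xs →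
             ∃₂ λ ys zs → xs ≡ ys ++ zs × length ys ≡ i × All (_< a) ys × All (a <_) zs
SplitAt-++ {xs = xs} (done p) = [] , xs , refl , refl , [] , p
SplitAt-++ (step {x = x} p s) with ys , zs , refl , refl , q , r ← SplitAt-++ s = x ∷ ys , zs , refl , refl , p ∷ q , r

size-decode-node : ∀ l {m r} → 0 < size (decode (node l m r))
size-decode-node leaf         = s≤s z≤n
size-decode-node (node _ _ _) = s≤s z≤n

Decodes : List ℕ → BT → Set
Decodes V t = Valid (decode t) × length V ≡ size (decode t) × realize (decode t) V ≡ t

-- Avoidance puts the left subtree without its maximum `m` below the right one, and `m` splits the
-- image of the latter. Sorting the pieces recovers the layout V₁, V₂, m, V₃, n of `realize`.
decode-node : ∀ {ll m lr n r V} → W₂ V (node (node ll m lr) n r) → Sorted V →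
  (∀ {U} → W₂ U (node ll m lr) → Sorted U → Decodes U (node ll m lr)) →
  (∀ {U} → W₂ U r → Sorted U → Decodes U r) →
  Decodes V (node (node ll m lr) n r)
decode-node {ll} {m} {lr} {n} {r} (w₂ (node dl@(node dll ll<m lr<m dlr) l<n r<n dr) p a) s ih-l ih-r
  with V′ , refl , q ← Sorted-last (inorder (node ll m lr)) s (↭-sym p) l<n r<n
  with av-λ , λ≺ρn , (_ , split-n) , av-ρn ← Avoids231-++⁻
    (↭.All-resp-↭ (↭-sym (↭.++⁺ (postorder-↭ ll) (postorder-↭ lr))) (All.++⁺ ll<m lr<m))
    (≡.subst Avoids231 (≡.trans (≡.cong (_++ postorder r ++ [ n ]) (≡.sym (List.++-assoc (postorder ll) (postorder lr) [ m ])))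
      (List.++-assoc (postorder ll ++ postorder lr) [ m ] (postorder r ++ [ n ]))) a)
  with (i , split) , _ ← SplitAt-++⁻ (postorder r) (All.lookup l<n (∈.∈-++⁺ʳ (inorder ll) (here refl))) split-n
  with ρ₁ , ρ₂ , ρ≡ , len₁ , ρ₁<m , m<ρ₂ ← SplitAt-++ split
  with V₁ , U , refl , p₁ , pU ← Sorted-split (inorder ll ++ inorder lr) (proj₁ (Sorted-++⁻ V′ s))
    (↭-trans q (↭-trans (↭.++⁺ʳ (inorder r) (↭.shift m (inorder ll) (inorder lr)))
      (↭-sym (↭.shift m (inorder ll ++ inorder lr) (inorder r)))))
    (≺-++ʳ {ys = [ m ]} (≺-[-] (All.++⁺ ll<m lr<m))
      (≺-resp-↭ (↭.++⁺ (postorder-↭ ll) (postorder-↭ lr)) (postorder-↭ r) (proj₁ (≺-++ʳ⁻ (postorder r) λ≺ρn))))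
  with V₂ , U′ , refl , p₂ , pU′ ← Sorted-split ρ₁ (proj₁ (proj₂ (Sorted-++⁻ V₁ (proj₁ (Sorted-++⁻ V′ s)))))
    (↭-trans pU (↭-trans (↭.prep m (↭-trans (↭-sym (postorder-↭ r)) (↭-reflexive ρ≡))) (↭-sym (↭.shift m ρ₁ ρ₂))))
    (≺-++ʳ {ys = [ m ]} (≺-[-] ρ₁<m) (All.map (λ x<m → All.map (ℕ.<-trans x<m) m<ρ₂) ρ₁<m))
  with M , V₃ , refl , pM , p₃ ← Sorted-split [ m ]
    (proj₁ (proj₂ (Sorted-++⁻ V₂ (proj₁ (proj₂ (Sorted-++⁻ V₁ (proj₁ (Sorted-++⁻ V′ s))))))))
    pU′ (m<ρ₂ ∷ [])
  with refl ← ↭.↭-singleton-inv pM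
  = ≡.subst (λ V → Decodes V (node (node ll m lr) n r)) (≡.sym reassoc) decodes
  where
  reassoc : (V₁ ++ V₂ ++ m ∷ V₃) ++ [ n ] ≡ V₁ ++ V₂ ++ m ∷ V₃ ++ [ n ]
  reassoc = ≡.trans (List.++-assoc V₁ (V₂ ++ m ∷ V₃) [ n ]) (≡.cong (V₁ ++_) (List.++-assoc V₂ (m ∷ V₃) [ n ]))
  s′ : Sorted (V₁ ++ V₂ ++ m ∷ V₃ ++ [ n ])
  s′ = ≡.subst Sorted reassoc s
  l↭ : inorder (node ll m lr) ↭ V₁ ++ [ m ]
  l↭ = ↭-trans (↭.shift m (inorder ll) (inorder lr)) (↭-trans (↭.prep m (↭-sym p₁)) (↭.∷↭∷ʳ m V₁))
  r↭ : inorder r ↭ V₂ ++ V₃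
  r↭ = ↭-trans (↭-sym (postorder-↭ r)) (↭-trans (↭-reflexive ρ≡) (↭.++⁺ (↭-sym p₂) (↭-sym p₃)))
  av-l : Avoids231 (postorder (node ll m lr))
  av-l = ≡.subst Avoids231 (List.++-assoc (postorder ll) (postorder lr) [ m ])
    (Avoids231-++⁺ (↭.All-resp-↭ (↭-sym (↭.++⁺ (postorder-↭ ll) (postorder-↭ lr))) (All.++⁺ ll<m lr<m))
      av-λ (≺-[] _) (0 , done []) tt)
  av-r : Avoids231 (postorder r)
  av-r = proj₁ (Avoids231-++⁻ (↭.All-resp-↭ (↭-sym (postorder-↭ r)) r<n) av-ρn)
  Dl = ih-l (w₂ dl l↭ av-l) (Sorted-V₁m {V₂ = V₂} {V₃ = V₃} s′)
  Dr = ih-r (w₂ dr r↭ av-r) (Sorted-V₂V₃ {V₁ = V₁} s′)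
  L = decode (node ll m lr)
  R = decode r
  len₂ : length V₂ ≡ below m (inorder r)
  len₂ = ≡.sym (≡.trans (below-↭ r↭) (below-++ V₂ (V₂<m {V₁ = V₁} s′) (m<V₃ {V₁ = V₁} {V₂ = V₂} s′)))
  i≡ : i ≡ below m (inorder r)
  i≡ = ≡.trans (≡.sym len₁) (≡.trans (≡.sym (↭.↭-length p₂)) len₂)
  -- The split at `m` is a cut of the image of `r`; the induction hypothesis identifies `r` with a
  -- realization, whose cuts are slots.
  slot : below m (inorder r) ∈ slots R
  slot = ≡.subst (_∈ slots R) i≡ (Realizes.cuts⁻ (realize-sound R (proj₁ Dr) (Sorted-V₂V₃ {V₁ = V₁} s′) (proj₁ (proj₂ Dr)))
    (≡.subst (λ t → Cut i (postorder t)) (≡.sym (proj₂ (proj₂ Dr))) (SplitAt-Cut split)))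
  lenL : suc (length V₁) ≡ size L
  lenL = ≡.trans (≡.sym (≡.trans (List.length-++ V₁) (ℕ.+-comm (length V₁) 1))) (proj₁ (proj₂ Dl))
  lenR : length V₂ ℕ.+ length V₃ ≡ size R
  lenR = ≡.trans (≡.sym (List.length-++ V₂)) (proj₁ (proj₂ Dr))
  len : length (V₁ ++ V₂ ++ m ∷ V₃ ++ [ n ]) ≡ suc (size L ℕ.+ size R)
  len = ≡.trans (≡.sym (↭.↭-length (entries-↭ {V₁} {V₂} {m} {V₃} {n} s′)))
    (≡.trans (List.length-++ (V₁ ++ [ m ]) {n ∷ V₂ ++ V₃}) (≡.trans (ℕ.+-suc (length (V₁ ++ [ m ])) (length (V₂ ++ V₃)))
      (≡.cong₂ (λ a b → suc (a ℕ.+ b)) (proj₁ (proj₂ Dl)) (proj₁ (proj₂ Dr)))))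
  len₃ : length V₃ ≡ size R ∸ below m (inorder r)
  len₃ = ≡.trans (≡.sym (ℕ.m+n∸m≡n (length V₂) (length V₃))) (≡.cong₂ _∸_ lenR len₂)
  decodes : Decodes (V₁ ++ V₂ ++ m ∷ V₃ ++ [ n ]) (node (node ll m lr) n r)
  decodes = (proj₁ Dl , size-decode-node ll , proj₁ Dr , slot) , len
    , ≡.trans (realize-node L R (below m (inorder r)) V₁ V₂ m V₃ n (≡.cong pred lenL) len₂ len₃)
        (≡.cong₂ (λ a b → node a n b) (proj₂ (proj₂ Dl)) (proj₂ (proj₂ Dr)))

decode-complete : ∀ t {V} → W₂ V t → Sorted V → Decodes V t
decode-complete leaf (w₂ _ p _) s with refl ← ↭.↭-empty-inv (↭-sym p) = tt , refl , refl
decode-complete (node leaf n r) (w₂ (node _ _ r<n dr) p a) s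
  with V′ , refl , q ← Sorted-last [] s (↭-sym p) [] r<n
  with v , len , eq ← decode-complete r (w₂ dr (↭-sym q) (proj₁ (Avoids231-++⁻ (↭.All-resp-↭ (↭-sym (postorder-↭ r)) r<n) a)))
                        (proj₁ (Sorted-++⁻ V′ s))
  = v , ≡.trans (List.length-++ V′) (≡.trans (ℕ.+-comm (length V′) 1) (≡.cong suc len))
      , ≡.trans (realize-top (decode r) len) (≡.cong (node leaf n) eq)
decode-complete (node l@(node _ _ _) n r) w s = decode-node w s (decode-complete l) (decode-complete r)

-- Counting preimages

++-≡-++-∷ : ∀ {m : ℕ} xs {ys} as {bs} → xs ++ ys ≡ as ++ m ∷ bs →
  (∃ λ zs → as ≡ xs ++ zs × ys ≡ zs ++ m ∷ bs) ⊎ (∃ λ zs → xs ≡ as ++ m ∷ zs × bs ≡ zs ++ ys)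
++-≡-++-∷ []       as       eq   = inj₁ (as , refl , eq)
++-≡-++-∷ (x ∷ xs) []       refl = inj₂ (xs , refl , refl)
++-≡-++-∷ (x ∷ xs) (a ∷ as) eq with refl , eq′ ← List.∷-injective eq with ++-≡-++-∷ xs as eq′
... | inj₁ (zs , refl , p) = inj₁ (zs , refl , p)
... | inj₂ (zs , refl , p) = inj₂ (zs , refl , p)

∈-splits⁻ : ∀ t {α β} → (α , β) ∈ splits t →
            inorder α ++ inorder β ≡ inorder t × (Decreasing t → Decreasing α × Decreasing β)
∈-splits⁻ leaf (here refl) = refl , λ _ → leaf , leaf
∈-splits⁻ (node l m r) p with ∈.∈-++⁻ (map (λ (α , β) → α , node β m r) (splits l)) p
... | inj₁ q with (α , β) , αβ∈ , refl ← ∈.∈-map⁻ (λ (α , β) → α , node β m r) q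
             with eq , dec ← ∈-splits⁻ l αβ∈
    = ≡.trans (≡.sym (List.++-assoc (inorder α) (inorder β) _)) (≡.cong (_++ m ∷ inorder r) eq)
    , λ { (node dl l<m r<m dr) → proj₁ (dec dl)
        , node (proj₂ (dec dl)) (All.++⁻ʳ (inorder α) (≡.subst (All (_< m)) (≡.sym eq) l<m)) r<m dr }
... | inj₂ q with (α , β) , αβ∈ , refl ← ∈.∈-map⁻ (λ (α , β) → node l m α , β) q
             with eq , dec ← ∈-splits⁻ r αβ∈
    = ≡.trans (List.++-assoc (inorder l) (m ∷ inorder α) _) (≡.cong (λ xs → inorder l ++ m ∷ xs) eq)
    , λ { (node dl l<m r<m dr) → node dl l<m (All.++⁻ˡ (inorder α) (≡.subst (All (_< m)) (≡.sym eq) r<m)) (proj₁ (dec dr))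
        , proj₂ (dec dr) }

∈-splits⁺ : ∀ t xs {ys} → xs ++ ys ≡ inorder t →
            ∃₂ λ α β → (α , β) ∈ splits t × inorder α ≡ xs × inorder β ≡ ys
∈-splits⁺ leaf [] refl = leaf , leaf , here refl , refl , refl
∈-splits⁺ (node l m r) xs eq with ++-≡-++-∷ xs (inorder l) eq
... | inj₁ (zs , eql , refl) with α , β , αβ∈ , refl , refl ← ∈-splits⁺ l xs (≡.sym eql)
  = α , node β m r , ∈.∈-++⁺ˡ (∈.∈-map⁺ (λ (α , β) → α , node β m r) αβ∈) , refl , refl
... | inj₂ (zs , refl , eqr) with α , β , αβ∈ , refl , refl ← ∈-splits⁺ r zs (≡.sym eqr)
  = node l m α , β , ∈.∈-++⁺ʳ _ (∈.∈-map⁺ (λ (α , β) → node l m α , β) αβ∈) , refl , refl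

-- A first component has at most as many entries as `l` when the cut precedes the root, and more
-- otherwise.
splits-unique : ∀ t → Unique (splits t)
splits-unique leaf         = [] ∷ []
splits-unique (node l m r) = Unique.++⁺
  (Unique.map⁺ (λ { refl → refl }) (splits-unique l)) (Unique.map⁺ (λ { refl → refl }) (splits-unique r))
  λ (p , q) → disjoint p q
  where
  disjoint : ∀ {αβ} → αβ ∈ map (λ (α , β) → α , node β m r) (splits l) →
             αβ ∉ map (λ (α , β) → node l m α , β) (splits r)
  disjoint p q with _ , αβ∈ , refl ← ∈.∈-map⁻ (λ (α , β) → α , node β m r) p
    with (α , β) , _ , refl ← ∈.∈-map⁻ (λ (α , β) → node l m α , β) q =
    ℕ.<-irrefl refl (ℕ.≤-trans
      (ℕ.≤-trans (s≤s (ℕ.m≤m+n (length (inorder l)) (length (inorder α))))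
        (ℕ.≤-reflexive (≡.trans (≡.sym (ℕ.+-suc _ _)) (≡.sym (List.length-++ (inorder l))))))
      (ℕ.≤-trans (ℕ.m≤m+n _ _) (ℕ.≤-reflexive (≡.trans (≡.sym (List.length-++ (inorder (node l m α))))
        (≡.cong length (proj₁ (∈-splits⁻ l αβ∈)))))))

-- The fuel bounds the number of nodes.
preimages : ℕ → BT → List BT
preimages _       leaf                      = [ leaf ]
preimages zero    (node _ _ _)              = []
preimages (suc f) (node l m leaf)           =
  concatMap (λ (α , β) → cartesianProductWith (λ u v → node u m v) (preimages f α) (preimages f β)) (splits l)
preimages (suc f) (node l m (node _ _ _))   = []

length-∑ : ∀ {I : Set} (is : List I) → + length is ≡ ∑ℤ.∑ (λ _ → + 1) is
length-∑ []       = refl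
length-∑ (i ∷ is) = ≡.cong (λ z → + 1 ℤ.+ z) (length-∑ is)

length-concatMap : ∀ {I J : Set} (h : I → List J) is → + length (concatMap h is) ≡ ∑ℤ.∑ (λ i → + length (h i)) is
length-concatMap h is = ≡.trans (length-∑ (concatMap h is)) (≡.trans (∑ℤ.∑-concatMap (λ _ → + 1) h is)
  (∑ℤ.∑-cong (λ i → ≡.sym (length-∑ (h i))) is))

length-cartesian : ∀ {I J K : Set} (f : I → J → K) is js →
                   + length (cartesianProductWith f is js) ≡ + length is ℤ.* + length js
length-cartesian f is js = ≡.trans (≡.cong +_ (lengthℕ is)) (ℤ.pos-* (length is) (length js))
  where
  lengthℕ : ∀ is → length (cartesianProductWith f is js) ≡ length is ℕ.* length js
  lengthℕ []       = refl
  lengthℕ (i ∷ is) = ≡.trans (List.length-++ (map (f i) js)) (≡.cong₂ ℕ._+_ (List.length-map (f i) js) (lengthℕ is))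

-- The identity at a = 0. Its right side is also the constant term of `gf (node l m leaf)`, as
-- `gf⁺ leaf` has constant term 1.
gf-splits-0 : ∀ l → ∑ℤ.∑ (λ (α , β) → gf α 0 ℤ.* gf β 0) (splits l) ≡ gf l 1
gf-splits-0 l = ≡.trans (≡.sym (∑A-coeff (λ (α , β) → A.const (gf α 0) A.✶ gf β) 0 (splits l)))
  (≡.trans (gf-splits l 0) (ℤ.*-identityˡ (gf l 1)))

record Preimages (us : List BT) (t : BT) : Set where
  constructor preimages-are
  field
    unique   : Unique us
    sound    : ∀ {u} → u ∈ us → Decreasing u × postorder u ≡ inorder t
    complete : ∀ {u} → Decreasing u → postorder u ≡ inorder t → u ∈ us
    count    : + length us ≡ gf t 0

postorder-∷ʳ : ∀ u₁ {n} u₂ → postorder (node u₁ n u₂) ≡ (postorder u₁ ++ postorder u₂) ++ [ n ]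
postorder-∷ʳ u₁ {n} u₂ = ≡.sym (List.++-assoc (postorder u₁) (postorder u₂) [ n ])

preimages-leaf : Preimages [ leaf ] leaf
preimages-leaf = preimages-are ([] ∷ []) (λ { (here refl) → leaf , refl }) complete refl
  where
  complete : ∀ {u} → Decreasing u → postorder u ≡ [] → u ∈ [ leaf ]
  complete leaf _ = here refl
  complete (node {l} {m} {r} _ _ _ _) eq =
    contradiction (≡.trans (≡.sym (postorder-∷ʳ l r)) eq) (++-∷-≢[] (postorder l ++ postorder r))

-- The postorder word of a nonempty decreasing tree ends with its maximum, but here entries follow
-- `m`. On the other side, the factor a in `gf⁺` makes the count 0.
preimages-node : ∀ {l m a k b} → Decreasing (node l m (node a k b)) → Preimages [] (node l m (node a k b))
preimages-node {l} {m} {a} {k} {b} (node _ _ r<m _) = preimages-are [] (λ ()) complete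
  (≡.sym (≡.trans (≡.cong (λ z → gf l 1 ℤ.* z) (ℤ.*-zeroˡ (gf (node a k b) 0))) (ℤ.*-zeroʳ (gf l 1))))
  where
  last∈ : ∀ xs {n : ℕ} as {cs} → xs ++ [ n ] ≡ as ++ cs → cs ≢ [] → n ∈ cs
  last∈ xs as {cs} eq cs≢[] with initLast cs
  ... | []       = contradiction refl cs≢[]
  ... | cs ∷ʳ′ c with _ , refl ← List.∷ʳ-injective xs (as ++ cs) (≡.trans eq (≡.sym (List.++-assoc as cs [ c ])))
    = ∈.∈-++⁺ʳ cs (here refl)
  complete : ∀ {u} → Decreasing u → postorder u ≡ inorder (node l m (node a k b)) → u ∈ []
  complete leaf eq = contradiction (≡.sym eq) (++-∷-≢[] (inorder l))
  complete {node u₁ n u₂} (node _ u₁<n u₂<n _) eq = contradiction n<m (ℕ.≤⇒≯ m≤n)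
    where
    eq′ : (postorder u₁ ++ postorder u₂) ++ [ n ] ≡ (inorder l ++ [ m ]) ++ inorder a ++ k ∷ inorder b
    eq′ = ≡.trans (≡.sym (postorder-∷ʳ u₁ u₂)) (≡.trans eq (≡.sym (List.++-assoc (inorder l) [ m ] _)))
    n<m : n < m
    n<m = All.lookup r<m (last∈ (postorder u₁ ++ postorder u₂) (inorder l ++ [ m ]) eq′ (++-∷-≢[] (inorder a)))
    m≤n : m ℕ.≤ n
    m≤n = All.lookup {P = ℕ._≤ n}
      (All.++⁺ (All.map ℕ.<⇒≤ u₁<n) (ℕ.≤-refl ∷ All.map ℕ.<⇒≤ u₂<n))
      (↭.∈-resp-↭ (postorder-↭ (node u₁ n u₂)) (≡.subst (m ∈_) (≡.sym eq) (∈.∈-++⁺ʳ (inorder l) (here refl))))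

-- The root of a preimage is the last entry `m`, and its subtrees are preimages of the two parts of
-- a cut of `l`. Their postorders recover the cut, so nothing is counted twice.
preimages-step : ∀ {l m} {p : BT → List BT} → Decreasing (node l m leaf) →
  (∀ {α β} → (α , β) ∈ splits l → Preimages (p α) α × Preimages (p β) β) →
  Preimages (concatMap (λ (α , β) → cartesianProductWith (λ u v → node u m v) (p α) (p β)) (splits l)) (node l m leaf)
preimages-step {l} {m} {p} (node dl l<m _ _) ih = preimages-are
  (concatMap-unique {f = F} (splits-unique l)
    (λ {(α , β)} αβ∈ → Unique.cartesianProductWith⁺ _ (λ { refl → refl , refl })
      (Preimages.unique (proj₁ (ih αβ∈))) (Preimages.unique (proj₂ (ih αβ∈)))) key)
  sound complete count
  where
  F : BT × BT → List BT
  F (α , β) = cartesianProductWith (λ u v → node u m v) (p α) (p β)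
  sound : ∀ {u} → u ∈ concatMap F (splits l) → Decreasing u × postorder u ≡ inorder l ++ [ m ]
  sound u∈ with (α , β) , αβ∈ , u∈F ← ∈-concatMap {f = F} {splits l} u∈
    with u₁ , u₂ , u₁∈ , u₂∈ , refl ← ∈.∈-cartesianProductWith⁻ (λ u v → node u m v) (p α) (p β) u∈F
    with d₁ , e₁ ← Preimages.sound (proj₁ (ih αβ∈)) u₁∈ | d₂ , e₂ ← Preimages.sound (proj₂ (ih αβ∈)) u₂∈
    with eq ← proj₁ (∈-splits⁻ l αβ∈)
    with α<m , β<m ← All.++⁻ (inorder α) (≡.subst (All (_< m)) (≡.sym eq) l<m)
    = node d₁ (↭.All-resp-↭ (postorder-↭ u₁) (≡.subst (All (_< m)) (≡.sym e₁) α<m))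
              (↭.All-resp-↭ (postorder-↭ u₂) (≡.subst (All (_< m)) (≡.sym e₂) β<m)) d₂
    , ≡.trans (postorder-∷ʳ u₁ u₂) (≡.cong (_++ [ m ]) (≡.trans (≡.cong₂ _++_ e₁ e₂) eq))
  complete : ∀ {u} → Decreasing u → postorder u ≡ inorder l ++ [ m ] → u ∈ concatMap F (splits l)
  complete leaf eq = contradiction (≡.sym eq) (++-∷-≢[] (inorder l))
  complete {node u₁ n u₂} (node d₁ _ _ d₂) eq
    with eq′ , refl ← List.∷ʳ-injective (postorder u₁ ++ postorder u₂) (inorder l) (≡.trans (≡.sym (postorder-∷ʳ u₁ u₂)) eq)
    with α , β , αβ∈ , e₁ , e₂ ← ∈-splits⁺ l (postorder u₁) eq′
    = ∈-concatMap′ {f = F} αβ∈ (∈.∈-cartesianProductWith⁺ _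
        (Preimages.complete (proj₁ (ih αβ∈)) d₁ (≡.sym e₁)) (Preimages.complete (proj₂ (ih αβ∈)) d₂ (≡.sym e₂)))
  key : ∀ {αβ γδ u} → αβ ∈ splits l → γδ ∈ splits l → u ∈ F αβ → u ∈ F γδ → αβ ≡ γδ
  key {α , β} {γ , δ} αβ∈ γδ∈ u∈ u∈′
    with u₁ , u₂ , u₁∈ , u₂∈ , refl ← ∈.∈-cartesianProductWith⁻ (λ u v → node u m v) (p α) (p β) u∈
    with _ , _ , u₁∈′ , u₂∈′ , refl ← ∈.∈-cartesianProductWith⁻ (λ u v → node u m v) (p γ) (p δ) u∈′
    with dα , dβ ← proj₂ (∈-splits⁻ l αβ∈) dl | dγ , dδ ← proj₂ (∈-splits⁻ l γδ∈) dl
    = ≡.cong₂ _,_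
        (inorder-injective dα dγ (≡.trans (≡.sym (proj₂ (Preimages.sound (proj₁ (ih αβ∈)) u₁∈)))
          (proj₂ (Preimages.sound (proj₁ (ih γδ∈)) u₁∈′))))
        (inorder-injective dβ dδ (≡.trans (≡.sym (proj₂ (Preimages.sound (proj₂ (ih αβ∈)) u₂∈)))
          (proj₂ (Preimages.sound (proj₂ (ih γδ∈)) u₂∈′))))
  count : + length (concatMap F (splits l)) ≡ gf (node l m leaf) 0
  count = ≡.trans (length-concatMap F (splits l))
    (≡.trans (∑ℤ.∑-cong-∈ (splits l) λ {(α , β)} αβ∈ → ≡.trans (length-cartesian (λ u v → node u m v) (p α) (p β))
      (≡.cong₂ ℤ._*_ (Preimages.count (proj₁ (ih αβ∈))) (Preimages.count (proj₂ (ih αβ∈)))))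
    (≡.trans (gf-splits-0 l) (≡.sym (ℤ.*-identityʳ (gf l 1)))))

preimages-correct : ∀ f t → Decreasing t → length (inorder t) ℕ.≤ f → Preimages (preimages f t) t
preimages-correct zero    leaf d len = preimages-leaf
preimages-correct (suc f) leaf d len = preimages-leaf
preimages-correct zero    (node l m r) d len =
  contradiction (≡.subst (ℕ._≤ 0) (≡.trans (List.length-++ (inorder l)) (ℕ.+-suc _ _)) len) λ ()
preimages-correct (suc f) (node l m (node _ _ _)) d len = preimages-node d
preimages-correct (suc f) (node l m leaf) d@(node dl _ _ _) len = preimages-step d λ {α} {β} αβ∈ →
  let eq , dec = ∈-splits⁻ l αβ∈
      dα , dβ = dec dl
      len′ = ≡.subst (ℕ._≤ f) (≡.trans (≡.cong length (≡.sym eq)) (List.length-++ (inorder α)))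
               (ℕ.s≤s⁻¹ (≡.subst (ℕ._≤ suc f) (≡.trans (List.length-++ (inorder l)) (ℕ.+-comm (length (inorder l)) 1)) len))
  in preimages-correct f α dα (ℕ.m+n≤o⇒m≤o _ len′) , preimages-correct f β dβ (ℕ.m+n≤o⇒n≤o (length (inorder α)) len′)

gf-realize : ∀ T V → gf (realize T V) ≡ gf (skeleton T)
gf⁺-realize : ∀ T V → gf⁺ (realize T V) ≡ gf⁺ (skeleton T)
gf-realize leaf         V = refl
gf-realize (top R)      V = ≡.cong (A.δ 𝟙+a A.✶_) (gf⁺-realize R _)
gf-realize (node L R i) V = ≡.cong₂ (λ f g → A.δ f A.✶ g) (gf-realize L _) (gf⁺-realize R _)
gf⁺-realize leaf           V = refl
gf⁺-realize T@(top _)      V = ≡.cong (A.var A.✶_) (gf-realize T V)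
gf⁺-realize T@(node _ _ _) V = ≡.cong (A.var A.✶_) (gf-realize T V)

Unique-resp-↭ : ∀ {xs ys : List ℕ} → xs ↭ ys → Unique xs → Unique ys
Unique-resp-↭ p = ↭ₛ.Unique-resp-↭ (≡.setoid ℕ) (↭⇒↭ₛ p)

map-unique : ∀ {I J : Set} {f : I → J} {is} → Unique is → (∀ {i k} → i ∈ is → k ∈ is → f i ≡ f k → i ≡ k) →
             Unique (map f is)
map-unique []       inj = []
map-unique (p ∷ us) inj =
  All.map⁺ (All.tabulate λ k∈ eq → All.lookup p k∈ (inj (here refl) (there k∈) eq))
  ∷ map-unique us (λ i∈ k∈ → inj (there i∈) (there k∈))

-- Counting 3-stack-sortable permutations

module _ (n : ℕ) where
  private
    V : List ℕ
    V = map suc (upTo n)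

    Sorted-V : Sorted V
    Sorted-V = AllPairs.map⁺ (AllPairs.applyUpTo⁺₁ id n λ i<j _ → s≤s i<j)

    length-V : length V ≡ n
    length-V = ≡.trans (List.length-map suc (upTo n)) (List.length-upTo n)

    unique-↭ : ∀ {xs} → xs ↭ V → Unique xs
    unique-↭ p = Unique-resp-↭ (↭-sym p) (AllPairs.map ℕ.<⇒≢ Sorted-V)

    realized : ∀ {T} → T ∈ trees n → Realizes T V (realize T V)
    realized T∈ with v , refl ← proj₁ (proj₂ (trees-enumerates n)) T∈ = realize-sound _ v Sorted-V length-V

    W₂-preimages : ∀ {t} → W₂ V t → Preimages (preimages n t) t
    W₂-preimages {t} (w₂ d p _) = preimages-correct n t d (ℕ.≤-reflexive (≡.trans (↭.↭-length p) length-V))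

    fibre : Tree → List BT
    fibre T = preimages n (realize T V)

    fibre-preimages : ∀ {T} → T ∈ trees n → Preimages (fibre T) (realize T V)
    fibre-preimages T∈ = W₂-preimages (Realizes.isW₂ (realized T∈))

    sortables : List BT
    sortables = concatMap fibre (trees n)

    P : List ℕ → Set
    P π = IsPerm n π × IsKStackSortable 3 π

    sortable-tree : ∀ {u} → u ∈ sortables → ∃ λ T → T ∈ trees n × Decreasing u × postorder u ≡ inorder (realize T V)
    sortable-tree u∈ with T , T∈ , u∈F ← ∈-concatMap {f = fibre} {trees n} u∈ = T , T∈ , Preimages.sound (fibre-preimages T∈) u∈F

    sortables-unique : Unique sortables
    sortables-unique = concatMap-unique (proj₁ (trees-enumerates n)) (λ T∈ → Preimages.unique (fibre-preimages T∈)) key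
      where
      key : ∀ {T S u} → T ∈ trees n → S ∈ trees n → u ∈ fibre T → u ∈ fibre S → T ≡ S
      -- The word `postorder u` determines its decreasing tree, from which `decode` recovers the
      -- shape.
      key T∈ S∈ u∈ u∈′ = ≡.trans (≡.sym (Realizes.decodes (realized T∈))) (≡.trans (≡.cong decode
        (inorder-injective (W₂.decreasing (Realizes.isW₂ (realized T∈))) (W₂.decreasing (Realizes.isW₂ (realized S∈)))
          (≡.trans (≡.sym (proj₂ (Preimages.sound (fibre-preimages T∈) u∈))) (proj₂ (Preimages.sound (fibre-preimages S∈) u∈′)))))
        (Realizes.decodes (realized S∈)))

    -- `u`, `t` and `v` are the decreasing trees of a word, of its image and of its second image.
    iterate₃ : ∀ {u t v} → Decreasing u → Decreasing t → Decreasing v →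
               postorder u ≡ inorder t → postorder t ≡ inorder v → iter 3 stackSort (inorder u) ≡ postorder v
    iterate₃ {u} {t} {v} du dt dv p q = ≡.trans (≡.cong stackSort (≡.trans (≡.cong stackSort
      (≡.trans (stackSort-inorder du) p)) (≡.trans (stackSort-inorder dt) q))) (stackSort-inorder dv)

    sound : ∀ {π} → π ∈ map inorder sortables → P π
    sound π∈ with u , u∈ , refl ← ∈.∈-map⁻ inorder π∈
      with T , T∈ , du , eq ← sortable-tree u∈
      with w₂ dt p a ← Realizes.isW₂ (realized T∈)
      = u↭V , ≡.subst Increasing (≡.sym (iterate₃ du dt dv eq (≡.sym (inorder-treeOf _))))
          (Linked.AllPairs⇒Linked (Sorted-postorder dv (≡.subst Avoids231 (≡.sym (inorder-treeOf _)) a)))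
      where
      u↭V : inorder u ↭ V
      u↭V = ↭-trans (↭-sym (postorder-↭ u)) (↭-trans (↭-reflexive eq) p)
      dv : Decreasing (treeOf (postorder (realize T V)))
      dv = treeOf-decreasing (unique-↭ (↭-trans (postorder-↭ (realize T V)) p))

    complete : ∀ {π} → P π → π ∈ map inorder sortables
    complete {π} (π↭V , inc) = ≡.subst (_∈ map inorder sortables) (inorder-treeOf π) (∈.∈-map⁺ inorder u∈)
      where
      u = treeOf π
      t = treeOf (postorder u)
      v = treeOf (postorder t)
      du : Decreasing u
      du = treeOf-decreasing (unique-↭ π↭V)
      u↭V : postorder u ↭ V
      u↭V = ↭-trans (postorder-↭ u) (↭-trans (↭-reflexive (inorder-treeOf π)) π↭V)
      dt : Decreasing t
      dt = treeOf-decreasing (unique-↭ u↭V)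
      t↭V : inorder t ↭ V
      t↭V = ↭-trans (↭-reflexive (inorder-treeOf (postorder u))) u↭V
      dv : Decreasing v
      dv = treeOf-decreasing (unique-↭ (↭-trans (postorder-↭ t) t↭V))
      sorted : Sorted (postorder v)
      sorted = Linked.Linked⇒AllPairs ℕ.<-trans (≡.subst Increasing (≡.trans
        (≡.cong (iter 3 stackSort) (≡.sym (inorder-treeOf π)))
        (iterate₃ du dt dv (≡.sym (inorder-treeOf (postorder u))) (≡.sym (inorder-treeOf (postorder t))))) inc)
      wt : W₂ V t
      wt = w₂ dt t↭V (≡.subst Avoids231 (inorder-treeOf (postorder t)) (postorder-avoids dv sorted))
      u∈ : u ∈ sortables
      u∈ with valid , len , eq ← decode-complete t wt Sorted-V =
        ∈-concatMap′ {f = fibre} (proj₂ (proj₂ (trees-enumerates n)) valid (≡.trans (≡.sym len) length-V))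
          (≡.subst (λ s → u ∈ preimages n s) (≡.sym eq)
            (Preimages.complete (W₂-preimages wt) du (≡.sym (inorder-treeOf (postorder u)))))

  sortable-count : ∃ λ w → HasCard P w × ∑ℤ.∑ (λ T → gf (skeleton T) 0) (trees n) ≡ + w
  sortable-count = length (map inorder sortables)
    , (map inorder sortables
      , map-unique sortables-unique (λ i∈ k∈ → inorder-injective (decreasing i∈) (decreasing k∈))
      , (λ π → mk⇔ sound complete) , refl)
    , ≡.sym (≡.trans (≡.cong +_ (List.length-map inorder sortables)) (≡.trans (length-concatMap fibre (trees n))
        (∑ℤ.∑-cong-∈ (trees n) (λ {T} T∈ → ≡.trans (Preimages.count (fibre-preimages T∈))
          (≡.cong (λ f → f 0) (gf-realize T V))))))
    where
    decreasing : ∀ {u} → u ∈ sortables → Decreasing u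
    decreasing u∈ = proj₁ (proj₂ (proj₂ (sortable-tree u∈)))

theorem2p1 : Σ Series λ Q →
    (PolyCoeffs Q × QEq Q)
    × (∀ Q′ → PolyCoeffs Q′ → QEq Q′ → Q′ ≈ₛ Q)
    × (Q 0 0 0 ≡ + 0)
    × (∀ n → Σ ℕ λ w →
    HasCard (λ π → IsPerm (suc n) π × IsKStackSortable 3 π) w
    × Q (suc n) 0 0 ≡ + w)
theorem2p1 = solution
  , (solution-polyCoeffs , solution-QEq)
  , (λ _ _ eq → QEq-unique eq solution-QEq)
  , refl
  , λ n → let w , card , eq = sortable-count (suc n) in w , card , ≡.trans (solution-00 n) eq
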